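{- Let $\mathcal F$ be a set of $2$-edge-coloured graphs on three vertices. In any of the following cases, the $\mathcal F$-free colouring problem reduces (in polynomial time) to $2$-SAT: (a) $\mathcal F$ contains no triangle; (b) $\mathcal F$ contains all triangles, i.e. $\{{}^rK_3,{}^bK_3,{}^{rrb}K_3,{}^{rbb}K_3\}\subseteq\mathcal F$; (c) the subset of triangles of $\mathcal F$ is $\{{}^rK_3,{}^{rrb}K_3\}$; (d) the subset of triangles of $\mathcal F$ is $\{{}^bK_3,{}^{rbb}K_3\}$.
   Context: Graphs are finite and simple. A $2$-edge-colouring of $G$ assigns to every edge the colour red or blue (not necessarily properly). For a set $\mathcal F$ of $2$-edge-coloured graphs, a $2$-edge-colouring of $G$ is $\mathcal F$-free if no induced $2$-edge-coloured subgraph is isomorphic (preserving colours) to a member of $\mathcal F$. The $\mathcal F$-free colouring problem is to decide whether an input graph $G$ admits an $\mathcal F$-free $2$-edge-colouring. The $2$-edge-coloured triangles are: ${}^rK_3$ (resp. ${}^bK_3$), with all edges red (resp. blue); ${}^{rrb}K_3$, with two red and one blue edge; ${}^{rbb}K_3$, with one red and two blue edges. The remaining $2$-edge-coloured graphs on three vertices, which may also belong to $\mathcal F$, are the edgeless graph, the two colourings of the one-edge graph, and the three colourings of the path $P_3$. -}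

module Defs where

open import Data.Bool.Base using (Bool; true; false; T)
open import Data.Fin.Base using (Fin)
open import Data.Fin.Patterns using (0F; 1F; 2F)
open import Data.List.Base using (List; []; _∷_; _++_; [_]; map; concatMap; replicate; allFin; length)
open import Data.List.Relation.Unary.All using (All)
open import Data.List.Relation.Unary.Any using (Any)
open import Data.Maybe.Base as Maybe using (Maybe; just; nothing)
open import Data.Nat.Base using (ℕ; suc; _+_; _*_; _^_; _≤_)
open import Data.Product using (Σ; Σ-syntax; ∃; ∃-syntax; _×_; _,_; proj₁; proj₂)
open import Data.Sum.Base using (_⊎_)
open import Data.Vec.Base as Vec using (Vec; _∷_)
open import Function.Base using (_∘_)
open import Function.Bundles using (_⇔_; _↔_; _↣_; module Inverse; module Injection)
open import Relation.Binary.Definitions using (Symmetric; Irreflexive)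
open import Relation.Binary.PropositionalEquality using (_≡_; refl; cong)
open import Relation.Nullary.Negation using (¬_)

------------------------------------------------------------------------
-- Multitape Turing machines

-- Every machine has the blank and the two bits on its tapes, and
-- finitely many further symbols of its own.

data Symbol (m : ℕ) : Set where
  blank : Symbol m
  bit   : Bool → Symbol m
  work  : Fin m → Symbol m

data Move : Set where
  left stay right : Move

-- A tape is infinite in both directions.  Both lists start next to the
-- head, and all cells beyond their ends are blank.

record Tape (m : ℕ) : Set where
  constructor tape
  field
    before : List (Symbol m)
    head   : Symbol m
    after  : List (Symbol m)

open Tape public

module _ {m : ℕ} where

  move : Move → Tape m → Tape m
  move left  (tape []       a rs)       = tape [] blank (a ∷ rs)
  move left  (tape (l ∷ ls) a rs)       = tape ls l (a ∷ rs)
  move stay  t                          = t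
  move right (tape ls       a [])       = tape (a ∷ ls) blank []
  move right (tape ls       a (r ∷ rs)) = tape (a ∷ ls) r rs

  act : Symbol m × Move → Tape m → Tape m
  act (a , d) t = move d record t { head = a }

  blankTape : Tape m
  blankTape = tape [] blank []

  write : List Bool → Tape m
  write []      = blankTape
  write (b ∷ w) = tape [] (bit b) (map bit w)

  readBits : List (Symbol m) → List Bool
  readBits (bit b ∷ as) = b ∷ readBits as
  readBits _            = []

  -- The word that begins under the head and extends to the right up to
  -- the first cell that does not hold a bit.

  read : Tape m → List Bool
  read t = readBits (head t ∷ after t)

-- Tape 0 is the input tape, tape 1 the output tape.  The machine halts
-- when δ yields nothing.

record TuringMachine : Set₁ where
  field
    State        : Set
    stateCount   : ℕ
    state-finite : State ↔ Fin stateCount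
    start        : State
    workSymbols  : ℕ
    workTapes    : ℕ

  tapes : ℕ
  tapes = 2 + workTapes

  field
    δ : State → Vec (Symbol workSymbols) tapes →
        Maybe (State × Vec (Symbol workSymbols × Move) tapes)

  Config : Set
  Config = State × Vec (Tape workSymbols) tapes

  initial : List Bool → Config
  initial w = start , write w ∷ Vec.replicate (suc workTapes) blankTape

  step : Config → Maybe Config
  step (q , ts) =
    Maybe.map (λ (q′ , as) → q′ , Vec.zipWith act as ts) (δ q (Vec.map head ts))

  output : Config → List Bool
  output (_ , _ ∷ t ∷ _) = read t

  -- c ⇓[ t ] w : started in c, the machine halts after exactly t steps
  -- with output w.

  data _⇓[_]_ (c : Config) : ℕ → List Bool → Set where
    halt : step c ≡ nothing → c ⇓[ 0 ] output c
    next : ∀ {c′ t w} → step c ≡ just c′ → c′ ⇓[ t ] w → c ⇓[ suc t ] w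

------------------------------------------------------------------------
-- Decision problems and polynomial-time many-one reductions

record Problem : Set₁ where
  field
    Instance : Set
    encode   : Instance → List Bool
    Yes      : Instance → Set

open Problem public

PolyTime : (P Q : Problem) → (Instance P → Instance Q) → Set₁
PolyTime P Q f =
  Σ[ M ∈ TuringMachine ] (let open TuringMachine M in
    ∃[ c ] ∃[ d ] ∀ x → ∃[ t ]
      t ≤ c * length (encode P x) ^ d + c ×
      initial (encode P x) ⇓[ t ] encode Q (f x))

infix 4 _≤ₚ_

_≤ₚ_ : Problem → Problem → Set₁
P ≤ₚ Q = Σ[ f ∈ (Instance P → Instance Q) ]
           PolyTime P Q f × (∀ x → Yes P x ⇔ Yes Q (f x))

------------------------------------------------------------------------
-- 2-SAT

unary : ℕ → List Bool
unary n = replicate n true ++ [ false ]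

record Literal : Set where
  constructor literal
  field
    sign : Bool      -- true for the variable itself, false for its negation
    var  : ℕ

open Literal public

-- The two literals may coincide, so that one-literal clauses are covered.

Clause : Set
Clause = Literal × Literal

2-CNF : Set
2-CNF = List Clause

encodeLiteral : Literal → List Bool
encodeLiteral l = sign l ∷ unary (var l)

encodeClause : Clause → List Bool
encodeClause (k , l) = encodeLiteral k ++ encodeLiteral l

Satisfies : (ℕ → Bool) → 2-CNF → Set
Satisfies ν = All λ (k , l) → ν (var k) ≡ sign k ⊎ ν (var l) ≡ sign l

2-SAT : Problem
2-SAT = record
  { Instance = 2-CNF
  ; encode   = concatMap encodeClause
  ; Yes      = λ φ → ∃[ ν ] Satisfies ν φ
  }

------------------------------------------------------------------------
-- Graphs and 2-edge-colourings

record Graph (n : ℕ) : Set where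
  field
    adjacent : Fin n → Fin n → Bool

  Edge : Fin n → Fin n → Set
  Edge u v = T (adjacent u v)

  field
    symmetric   : Symmetric Edge
    irreflexive : Irreflexive _≡_ Edge

open Graph public

encodeGraph : ∃ Graph → List Bool
encodeGraph (n , G) =
  unary n ++ concatMap (λ u → map (adjacent G u) (allFin n)) (allFin n)

data Colour : Set where
  red blue : Colour

record Colouring {n : ℕ} (G : Graph n) : Set where
  field
    colour     : ∀ {u v} → Edge G u v → Colour
    undirected : ∀ {u v} (e : Edge G u v) (e′ : Edge G v u) → colour e ≡ colour e′

open Colouring public

ColouredGraph : ℕ → Set
ColouredGraph n = Σ[ G ∈ Graph n ] Colouring G

infix 4 _≅_ _∈≅_

record _≅_ {m n : ℕ} (H : ColouredGraph m) (K : ColouredGraph n) : Set where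
  field
    vertices : Fin m ↔ Fin n

  open Inverse vertices public using (to)

  field
    edges   : ∀ u v → Edge (proj₁ H) u v ⇔ Edge (proj₁ K) (to u) (to v)
    colours : ∀ {u v} (e : Edge (proj₁ H) u v) (e′ : Edge (proj₁ K) (to u) (to v)) →
              colour (proj₂ H) e ≡ colour (proj₂ K) e′

-- The subgraph induced on the image of ι, with its vertices named by ι.

induced : ∀ {m n} → ColouredGraph n → Fin m ↣ Fin n → ColouredGraph m
induced (G , c) ι =
  record
    { adjacent    = λ u v → adjacent G (to u) (to v)
    ; symmetric   = symmetric G
    ; irreflexive = irreflexive G ∘ cong to
    } ,
  record
    { colour     = colour c
    ; undirected = undirected c
    }
  where open Injection ι using (to)

-- A set of coloured graphs on three vertices is represented by a list,
-- membership being taken up to isomorphism; there are only ten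
-- isomorphism types.

_∈≅_ : ColouredGraph 3 → List (ColouredGraph 3) → Set
H ∈≅ 𝓕 = Any (H ≅_) 𝓕

Free : ∀ {n} → List (ColouredGraph 3) → ColouredGraph n → Set
Free {n} 𝓕 G = (ι : Fin 3 ↣ Fin n) → ¬ (induced G ι ∈≅ 𝓕)

FreeColouring : List (ColouredGraph 3) → Problem
FreeColouring 𝓕 = record
  { Instance = ∃ Graph
  ; encode   = encodeGraph
  ; Yes      = λ (n , G) → Σ[ c ∈ Colouring G ] Free 𝓕 (G , c)
  }

------------------------------------------------------------------------
-- Triangles

K₃ : Graph 3
K₃ = record
  { adjacent    = adj
  ; symmetric   = λ {u v} → adj-sym u v
  ; irreflexive = λ {u v} → adj-irrefl u v
  }
  where
  adj : Fin 3 → Fin 3 → Bool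
  adj 0F 0F = false
  adj 1F 1F = false
  adj 2F 2F = false
  adj _  _  = true

  adj-sym : ∀ u v → T (adj u v) → T (adj v u)
  adj-sym 0F 1F _ = _
  adj-sym 0F 2F _ = _
  adj-sym 1F 0F _ = _
  adj-sym 1F 2F _ = _
  adj-sym 2F 0F _ = _
  adj-sym 2F 1F _ = _
  adj-sym 2F 2F ()

  adj-irrefl : ∀ u v → u ≡ v → ¬ T (adj u v)
  adj-irrefl 0F _ refl ()
  adj-irrefl 1F _ refl ()
  adj-irrefl 2F _ refl ()

-- The arguments are the colours of the edges 01, 02 and 12.

triangle : Colour → Colour → Colour → ColouredGraph 3
triangle x y z = K₃ , record { colour = λ {u v} → col u v ; undirected = λ {u v} → und u v }
  where
  col : ∀ u v → Edge K₃ u v → Colour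
  col 0F 1F _ = x
  col 1F 0F _ = x
  col 0F 2F _ = y
  col 2F 0F _ = y
  col 1F 2F _ = z
  col 2F 1F _ = z
  col 2F 2F ()

  und : ∀ u v (e : Edge K₃ u v) (e′ : Edge K₃ v u) → col u v e ≡ col v u e′
  und 0F 1F _ _ = refl
  und 0F 2F _ _ = refl
  und 1F 0F _ _ = refl
  und 1F 2F _ _ = refl
  und 2F 0F _ _ = refl
  und 2F 1F _ _ = refl
  und 2F 2F ()

rK₃ bK₃ rrbK₃ rbbK₃ : ColouredGraph 3
rK₃   = triangle red  red  red
bK₃   = triangle blue blue blue
rrbK₃ = triangle red  red  blue
rbbK₃ = triangle red  blue blue

triangles : List (ColouredGraph 3)
triangles = rK₃ ∷ bK₃ ∷ rrbK₃ ∷ rbbK₃ ∷ []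

-- The subset of triangles of 𝓕 is 𝓣.

TrianglesOf_Are_ : (𝓕 𝓣 : List (ColouredGraph 3)) → Set
TrianglesOf 𝓕 Are 𝓣 = ∀ H → (H ∈≅ triangles × H ∈≅ 𝓕) ⇔ H ∈≅ 𝓣

{-# OPTIONS --safe #-}
module Submission where

-- The colour of an edge uv with u < v is a Boolean variable.  For vertices
-- u < v < w, a pair of colours of two of uv, uw, vw is excluded by a clause
-- when both of its extensions to the third slot are forbidden.  These clauses
-- describe the free colourings as soon as every forbidden colouring of a
-- triple stays forbidden under some change of a single slot: at a non-edge,
-- any change will do, and on triangles this is what the four cases provide.
--
-- The machine writes three copies of the adjacency matrix, one head for each
-- of uv, uw and vw, with the cells on and below the diagonal blotted out.  It
-- runs through all u, v, w and uses the distance from a head to the left end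
-- of its tape as the name of the variable.

open import Defs
open import Data.Bool.Base using (Bool; true; false; not; _∧_; if_then_else_; T)
open import Data.Bool.Properties using (not-¬)
open import Data.Empty using (⊥; ⊥-elim)
open import Data.Fin.Base as Fin using (Fin; zero; suc; toℕ)
open import Data.Fin.Patterns using (0F; 1F; 2F; 3F)
open import Data.Fin.Properties as Fin using (1↔⊤; +↔⊎; all?; any?; <-cmp)
open import Data.List.Base
  using (List; []; _∷_; _++_; [_]; map; concatMap; foldl; allFin; replicate; length; reverse; _ʳ++_)
open import Data.List.Membership.Propositional.Properties using (∈-allFin)
open import Data.List.Properties
  using (++-assoc; ++-ʳ++; ʳ++-defn; length-++; length-map; length-reverse; length-tabulate;
         length-replicate; map-++; map-∘; map-replicate; map-tabulate; reverse-involutive)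
open import Data.List.Relation.Unary.All as All using (All; []; _∷_)
import Data.List.Relation.Unary.All.Properties as All
open import Data.List.Relation.Unary.Any as Any using (here; there)
open import Data.Maybe as Maybe using (Maybe; just; nothing; maybe′; is-just; to-witness-T)
import Data.Maybe.Properties as Maybe
open import Data.Nat.Base using (ℕ; zero; suc; _+_; _*_; _^_; _≤_; _<_; _<ᵇ_; _⊓_; _⊔_; z≤n; s≤s; z<s; s<s)
import Data.Nat.Properties as ℕ
open import Data.Product using (∃; ∃-syntax; _×_; _,_; proj₁; proj₂)
open import Data.Sum.Base using (_⊎_; inj₁; inj₂)
open import Data.Sum.Function.Propositional using (_⊎-↔_)
open import Data.Unit.Base using (⊤; tt)
open import Data.Vec.Base as Vec using (Vec; []; _∷_; lookup; tabulate; insertAt)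
open import Data.Vec.Properties using (lookup∘tabulate)
open import Function.Base using (_∘_; id)
open import Function.Bundles
  using (_⇔_; _↔_; _↣_; mk⇔; mk↔ₛ′; module Equivalence; module Inverse; module Injection)
open import Function.Construct.Composition using (_↔-∘_)
open import Function.Construct.Symmetry using (↔-sym)
open import Relation.Binary.Definitions using (DecidableEquality; tri<; tri≈; tri>)
open import Relation.Binary.PropositionalEquality hiding ([_])
open import Relation.Nullary.Decidable
  using (Dec; yes; no; does; map′; True; toWitness; _×-dec_; dec-true; does-⇔)
open import Relation.Nullary.Negation using (¬_; contradiction)

-- Structured programs for Turing machines

-- A forbidden triple fixes three colours and would naturally give a clause with three literals. A
-- non-edge carries a dummy variable; hence graphs with fewer than three edges need no clauses of
-- another shape.
--
-- The reduction must come with an explicit machine, and this decides its design. With unary names a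
-- literal is the record of a walk along the tape, so no number is ever computed. Blotting the lower
-- half of the matrix replaces every comparison of vertices during the enumeration. Since the set of
-- forbidden graphs is fixed, the clauses that belong to three adjacency bits are part of the finite
-- control. The machine itself is composed from program pieces whose effect and time bound are
-- proved together.

module Programs (m k : ℕ) where

  Heads : Set
  Heads = Vec (Symbol m) k

  Actions : Set
  Actions = Vec (Symbol m × Move) k

  Tapes : Set
  Tapes = Vec (Tape m) k

  infixr 5 _⨾_

  data Program : Set where
    perform : (Heads → Actions) → Program
    _⨾_     : Program → Program → Program
    branch  : (Heads → Bool) → Program → Program → Program
    while   : (Heads → Bool) → Program → Program

  keep : Symbol m → Symbol m × Move
  keep a = a , stay

  apply : Actions → Tapes → Tapes
  apply = Vec.zipWith act

  -- A test leaves the tapes alone, but only propositionally: `Vec.zipWith` is stuck on a variable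
  -- vector of tapes. Runs through a test are transported along this equation.
  apply-keep : ∀ {j} (ts : Vec (Tape m) j) →
               Vec.zipWith act (Vec.map keep (Vec.map head ts)) ts ≡ ts
  apply-keep []       = refl
  apply-keep (t ∷ ts) = cong (t ∷_) (apply-keep ts)

  -- The control states. Each `perform` is one of them, and each test of a `branch` or `while` is a
  -- further one, the extra ⊤, which costs a step of its own.
  Point : Program → Set
  Point (perform f)    = ⊤
  Point (p ⨾ q)        = Point p ⊎ Point q
  Point (branch P p q) = ⊤ ⊎ (Point p ⊎ Point q)
  Point (while P p)    = ⊤ ⊎ Point p

  size : Program → ℕ
  size (perform f)    = 1
  size (p ⨾ q)        = size p + size q
  size (branch P p q) = 1 + (size p + size q)
  size (while P p)    = 1 + size p

  point-finite : ∀ p → Point p ↔ Fin (size p)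
  point-finite (perform f)    = ↔-sym 1↔⊤
  point-finite (p ⨾ q)        = ↔-sym +↔⊎ ↔-∘ (point-finite p ⊎-↔ point-finite q)
  point-finite (branch P p q) =
    ↔-sym (+↔⊎ {1}) ↔-∘ (↔-sym 1↔⊤ ⊎-↔ (↔-sym +↔⊎ ↔-∘ (point-finite p ⊎-↔ point-finite q)))
  point-finite (while P p)    = ↔-sym (+↔⊎ {1}) ↔-∘ (↔-sym 1↔⊤ ⊎-↔ point-finite p)

  firstPoint : ∀ p → Point p
  firstPoint (perform f)    = tt
  firstPoint (p ⨾ q)        = inj₁ (firstPoint p)
  firstPoint (branch P p q) = inj₁ tt
  firstPoint (while P p)    = inj₁ tt

  -- Leaving the program is the successor nothing.

  successor : ∀ p → Point p → Heads → Maybe (Point p)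
  successor (perform f)    _        hs = nothing
  successor (p ⨾ q)        (inj₁ s) hs = just (maybe′ inj₁ (inj₂ (firstPoint q)) (successor p s hs))
  successor (p ⨾ q)        (inj₂ s) hs = Maybe.map inj₂ (successor q s hs)
  successor (branch P p q) (inj₁ _) hs =
    just (inj₂ (if P hs then inj₁ (firstPoint p) else inj₂ (firstPoint q)))
  successor (branch P p q) (inj₂ (inj₁ s)) hs = Maybe.map (λ s → inj₂ (inj₁ s)) (successor p s hs)
  successor (branch P p q) (inj₂ (inj₂ s)) hs = Maybe.map (λ s → inj₂ (inj₂ s)) (successor q s hs)
  successor (while P p)    (inj₁ _) hs = if P hs then just (inj₂ (firstPoint p)) else nothing
  successor (while P p)    (inj₂ s) hs = just (maybe′ inj₂ (inj₁ tt) (successor p s hs))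

  actions : ∀ p → Point p → Heads → Actions
  actions (perform f)    _               hs = f hs
  actions (p ⨾ q)        (inj₁ s)        hs = actions p s hs
  actions (p ⨾ q)        (inj₂ s)        hs = actions q s hs
  actions (branch P p q) (inj₁ _)        hs = Vec.map keep hs
  actions (branch P p q) (inj₂ (inj₁ s)) hs = actions p s hs
  actions (branch P p q) (inj₂ (inj₂ s)) hs = actions q s hs
  actions (while P p)    (inj₁ _)        hs = Vec.map keep hs
  actions (while P p)    (inj₂ s)        hs = actions p s hs

  after-step : ∀ p → Point p → Tapes → Tapes
  after-step p s ts = apply (actions p s (Vec.map head ts)) ts

  data Path (p : Program) (s : Point p) (ts : Tapes) : ℕ → Tapes → Set where
    leave : successor p s (Vec.map head ts) ≡ nothing → Path p s ts 1 (after-step p s ts)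
    go-on : ∀ {s′ t us} → successor p s (Vec.map head ts) ≡ just s′ →
            Path p s′ (after-step p s ts) t us → Path p s ts (suc t) us

  -- Only a bound on the time shows in the type, so that branches and passes of different lengths
  -- can share one.
  record Runs (p : Program) (b : ℕ) (ts us : Tapes) : Set where
    constructor runs
    field
      {time} : ℕ
      bound  : time ≤ b
      path   : Path p (firstPoint p) ts time us

  slower : ∀ {p b c ts us} → b ≤ c → Runs p b ts us → Runs p c ts us
  slower b≤c (runs t≤b π) = runs (ℕ.≤-trans t≤b b≤c) π

  runs-perform : ∀ {f ts us} → apply (f (Vec.map head ts)) ts ≡ us → Runs (perform f) 1 ts us
  runs-perform refl = runs ℕ.≤-refl (leave refl)

  module _ {p q : Program} where

    ⨾-second : ∀ {s t ts us} → Path q s ts t us → Path (p ⨾ q) (inj₂ s) ts t us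
    ⨾-second (leave eq)   = leave (cong (Maybe.map inj₂) eq)
    ⨾-second (go-on eq π) = go-on (cong (Maybe.map inj₂) eq) (⨾-second π)

    ⨾-first : ∀ {s t t′ ts us vs} → Path p s ts t us → Path q (firstPoint q) us t′ vs →
              Path (p ⨾ q) (inj₁ s) ts (t + t′) vs
    ⨾-first (leave eq)   ρ = go-on (cong (λ s → just (maybe′ inj₁ _ s)) eq) (⨾-second ρ)
    ⨾-first (go-on eq π) ρ = go-on (cong (λ s → just (maybe′ inj₁ _ s)) eq) (⨾-first π ρ)

    infixr 5 _then_

    _then_ : ∀ {b c ts us vs} → Runs p b ts us → Runs q c us vs → Runs (p ⨾ q) (b + c) ts vs
    runs t≤b π then runs t≤c ρ = runs (ℕ.+-mono-≤ t≤b t≤c) (⨾-first π ρ)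

    module _ {P : Heads → Bool} where

      branch-left : ∀ {s t ts us} → Path p s ts t us →
                    Path (branch P p q) (inj₂ (inj₁ s)) ts t us
      branch-left (leave eq)   = leave (cong (Maybe.map _) eq)
      branch-left (go-on eq π) = go-on (cong (Maybe.map _) eq) (branch-left π)

      branch-right : ∀ {s t ts us} → Path q s ts t us →
                     Path (branch P p q) (inj₂ (inj₂ s)) ts t us
      branch-right (leave eq)   = leave (cong (Maybe.map _) eq)
      branch-right (go-on eq π) = go-on (cong (Maybe.map _) eq) (branch-right π)

      runs-true : ∀ {b ts us} → P (Vec.map head ts) ≡ true →
                  Runs p b ts us → Runs (branch P p q) (suc b) ts us
      runs-true {ts = ts} eq (runs t≤b π) = runs (s≤s t≤b)
        (go-on (cong (λ b → just (inj₂ (if b then _ else _))) eq)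
          (subst (λ ts → Path _ _ ts _ _) (sym (apply-keep ts)) (branch-left π)))

      runs-false : ∀ {b ts us} → P (Vec.map head ts) ≡ false →
                   Runs q b ts us → Runs (branch P p q) (suc b) ts us
      runs-false {ts = ts} eq (runs t≤b π) = runs (s≤s t≤b)
        (go-on (cong (λ b → just (inj₂ (if b then _ else _))) eq)
          (subst (λ ts → Path _ _ ts _ _) (sym (apply-keep ts)) (branch-right π)))

  module _ {P : Heads → Bool} {p : Program} where

    while-body : ∀ {s t t′ ts us vs} → Path p s ts t us → Path (while P p) (inj₁ tt) us t′ vs →
                 Path (while P p) (inj₂ s) ts (t + t′) vs
    while-body (leave eq)   ρ = go-on (cong (λ s → just (maybe′ inj₂ _ s)) eq) ρ
    while-body (go-on eq π) ρ = go-on (cong (λ s → just (maybe′ inj₂ _ s)) eq) (while-body π ρ)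

    runs-stop : ∀ {ts} → P (Vec.map head ts) ≡ false → Runs (while P p) 1 ts ts
    runs-stop {ts} eq = runs ℕ.≤-refl
      (subst (Path (while P p) _ ts 1) (apply-keep ts)
        (leave (cong (λ b → if b then just (inj₂ (firstPoint p)) else nothing) eq)))

    runs-again : ∀ {b c ts us vs} → P (Vec.map head ts) ≡ true →
                 Runs p b ts us → Runs (while P p) c us vs → Runs (while P p) (suc (b + c)) ts vs
    runs-again {ts = ts} eq (runs t≤b π) (runs t≤c ρ) = runs (s≤s (ℕ.+-mono-≤ t≤b t≤c))
      (go-on (cong (λ b → if b then just (inj₂ (firstPoint p)) else nothing) eq)
        (subst (λ ts → Path _ _ ts _ _) (sym (apply-keep ts)) (while-body π ρ)))

-- From programs to halting machines

module Compile {m k : ℕ} (p : Programs.Program m (2 + k)) where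

  open Programs m (2 + k)

  -- The state `inj₁ tt` is added for halting, because a machine halts without acting, whereas the
  -- last step of a path still acts.
  machine : TuringMachine
  machine = record
    { State        = ⊤ ⊎ Point p
    ; stateCount   = 1 + size p
    ; state-finite = ↔-sym (+↔⊎ {1}) ↔-∘ (↔-sym 1↔⊤ ⊎-↔ point-finite p)
    ; start        = inj₂ (firstPoint p)
    ; workSymbols  = m
    ; workTapes    = k
    ; δ            = λ where
        (inj₁ _) hs → nothing
        (inj₂ s) hs → just (maybe′ inj₂ (inj₁ tt) (successor p s hs) , actions p s hs)
    }

  open TuringMachine machine using (initial; output; _⇓[_]_; halt; next)

  path-halts : ∀ {s t ts us} → Path p s ts t us → (inj₂ s , ts) ⇓[ t ] output (inj₁ tt , us)
  path-halts {s} {ts = ts} (leave eq)   =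
    next (cong (λ s′ → just (maybe′ inj₂ _ s′ , after-step p s ts)) eq) (halt refl)
  path-halts {s} {ts = ts} (go-on eq π) =
    next (cong (λ s′ → just (maybe′ inj₂ _ s′ , after-step p s ts)) eq) (path-halts π)

  runs-halts : ∀ {b w us} → Runs p b (proj₂ (initial w)) us →
               ∃[ t ] t ≤ b × initial w ⇓[ t ] output (inj₁ tt , us)
  runs-halts (runs t≤b π) = _ , t≤b , path-halts π

-- Coloured graphs as symmetric matrices

_≟ᶜ_ : DecidableEquality Colour
red  ≟ᶜ red  = yes refl
red  ≟ᶜ blue = no λ ()
blue ≟ᶜ red  = no λ ()
blue ≟ᶜ blue = yes refl

-- Adjacency and colour become one value, so that an isomorphism is a bijection preserving entries
-- and no edge proofs occur in the equations.
label : (b : Bool) → (T b → Colour) → Maybe Colour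
label true  f = just (f tt)
label false f = nothing

entry : ∀ {n} → ColouredGraph n → Fin n → Fin n → Maybe Colour
entry (G , c) u v = label (adjacent G u v) (colour c)

label-edge : ∀ b (f : T b → Colour) e → label b f ≡ just (f e)
label-edge true f e = refl

edge-label : ∀ {b x} {f : T b → Colour} → label b f ≡ just x → T b
edge-label {true} eq = tt

label-cong : ∀ {b b′} {f : T b → Colour} {f′ : T b′ → Colour} →
             T b ⇔ T b′ → (∀ e e′ → f e ≡ f′ e′) → label b f ≡ label b′ f′
label-cong {true}  {true}  eq f≡f′ = cong just (f≡f′ tt tt)
label-cong {true}  {false} eq f≡f′ = ⊥-elim (Equivalence.to eq tt)
label-cong {false} {true}  eq f≡f′ = ⊥-elim (Equivalence.from eq tt)
label-cong {false} {false} eq f≡f′ = refl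

entry-diagonal : ∀ {n} (H : ColouredGraph n) u → entry H u u ≡ nothing
entry-diagonal (G , c) u with adjacent G u u | irreflexive G {u} refl | colour c {u} {u}
... | true  | ¬e | _ = ⊥-elim (¬e tt)
... | false | _  | _ = refl

entry-symmetric : ∀ {n} (H : ColouredGraph n) u v → entry H u v ≡ entry H v u
entry-symmetric (G , c) u v =
  label-cong (mk⇔ (symmetric G) (symmetric G)) (undirected c)

module _ {m n} {H : ColouredGraph m} {K : ColouredGraph n} where

  entries : (i : H ≅ K) → ∀ u v → entry H u v ≡ entry K (_≅_.to i u) (_≅_.to i v)
  entries i u v = label-cong (edges u v) colours
    where open _≅_ i

  fromEntries : (σ : Fin m ↔ Fin n) →
                (∀ u v → entry H u v ≡ entry K (Inverse.to σ u) (Inverse.to σ v)) → H ≅ K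
  fromEntries σ eq = record
    { vertices = σ
    ; edges    = λ u v → mk⇔
        (λ e → edge-label (trans (sym (eq u v)) (label-edge _ (colour (proj₂ H)) e)))
        (λ e → edge-label (trans (eq u v) (label-edge _ (colour (proj₂ K)) e)))
    ; colours  = λ {u} {v} e e′ → Maybe.just-injective
        (trans (sym (label-edge _ (colour (proj₂ H)) e))
          (trans (eq u v) (label-edge _ (colour (proj₂ K)) e′)))
    }

≅-sym : ∀ {m n} {H : ColouredGraph m} {K : ColouredGraph n} → H ≅ K → K ≅ H
≅-sym {K = K} i = fromEntries (↔-sym vertices) λ u v →
  trans (cong₂ (entry K) (sym (Inverse.strictlyInverseˡ vertices u))
                         (sym (Inverse.strictlyInverseˡ vertices v)))
        (sym (entries i _ _))
  where open _≅_ i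

≅-trans : ∀ {l m n} {H : ColouredGraph l} {K : ColouredGraph m} {L : ColouredGraph n} →
          H ≅ K → K ≅ L → H ≅ L
≅-trans i j = fromEntries (_≅_.vertices j ↔-∘ _≅_.vertices i)
  λ u v → trans (entries i u v) (entries j _ _)

∈≅-resp : ∀ {H K 𝓕} → H ≅ K → K ∈≅ 𝓕 → H ∈≅ 𝓕
∈≅-resp i = Any.map (≅-trans i)

abstract

  -- A search among the 27 maps on three points, once for the bijection and once for its inverse.
  -- The table of forbidden patterns built into the machine comes from it; `abstract` keeps it from
  -- unfolding in later goals.
  _≅?_ : (H K : ColouredGraph 3) → Dec (H ≅ K)
  H ≅? K = map′ to′ from′ (any-vec? λ f → any-vec? λ g →
      all? (λ u → lookup f (lookup g u) Fin.≟ u) ×-dec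
      all? (λ u → lookup g (lookup f u) Fin.≟ u) ×-dec
      all? λ u → all? λ v → Maybe.≡-dec _≟ᶜ_ (entry H u v) (entry K (lookup f u) (lookup f v)))
    where
    any-vec? : {P : Vec (Fin 3) 3 → Set} → (∀ f → Dec (P f)) → Dec (∃ P)
    any-vec? P? = map′ (λ (a , b , c , p) → (a ∷ b ∷ c ∷ []) , p)
                       (λ { (a ∷ b ∷ c ∷ [] , p) → a , b , c , p })
                       (any? λ a → any? λ b → any? λ c → P? (a ∷ b ∷ c ∷ []))

    Iso : Set
    Iso = ∃[ f ] ∃[ g ] (∀ u → lookup f (lookup g u) ≡ u) × (∀ u → lookup g (lookup f u) ≡ u) ×
          (∀ u v → entry H u v ≡ entry K (lookup f u) (lookup f v))

    to′ : Iso → H ≅ K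
    to′ (f , g , fg , gf , eq) = fromEntries (mk↔ₛ′ (lookup f) (lookup g) fg gf) eq

    from′ : H ≅ K → Iso
    from′ i = tabulate to , tabulate from ,
      (λ u → trans (lookup∘tabulate to _)
               (trans (cong to (lookup∘tabulate from u)) (strictlyInverseˡ u))) ,
      (λ u → trans (lookup∘tabulate from _)
               (trans (cong from (lookup∘tabulate to u)) (strictlyInverseʳ u))) ,
      λ u v → trans (entries i u v)
        (sym (cong₂ (entry K) (lookup∘tabulate to u) (lookup∘tabulate to v)))
      where open Inverse (_≅_.vertices i)

_∈≅?_ : ∀ H 𝓕 → Dec (H ∈≅ 𝓕)
H ∈≅? 𝓕 = Any.any? (H ≅?_) 𝓕

-- Graphs on three vertices given by their three slots

matrix : (x y z : Maybe Colour) → Fin 3 → Fin 3 → Maybe Colour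
matrix x y z 0F 1F = x
matrix x y z 1F 0F = x
matrix x y z 0F 2F = y
matrix x y z 2F 0F = y
matrix x y z 1F 2F = z
matrix x y z 2F 1F = z
matrix x y z 0F 0F = nothing
matrix x y z 1F 1F = nothing
matrix x y z 2F 2F = nothing

matrix-symmetric : ∀ x y z u v → matrix x y z u v ≡ matrix x y z v u
matrix-symmetric x y z 0F 0F = refl
matrix-symmetric x y z 0F 1F = refl
matrix-symmetric x y z 0F 2F = refl
matrix-symmetric x y z 1F 0F = refl
matrix-symmetric x y z 1F 1F = refl
matrix-symmetric x y z 1F 2F = refl
matrix-symmetric x y z 2F 0F = refl
matrix-symmetric x y z 2F 1F = refl
matrix-symmetric x y z 2F 2F = refl

matrix-diagonal : ∀ x y z u → matrix x y z u u ≡ nothing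
matrix-diagonal x y z 0F = refl
matrix-diagonal x y z 1F = refl
matrix-diagonal x y z 2F = refl

tri : (x y z : Maybe Colour) → ColouredGraph 3
tri x y z =
  record
    { adjacent    = λ u v → is-just (s u v)
    ; symmetric   = λ {u} {v} → subst (T ∘ is-just) (matrix-symmetric x y z u v)
    ; irreflexive = λ { {u} refl → subst (T ∘ is-just) (matrix-diagonal x y z u) }
    } ,
  record
    { colour     = λ {u} {v} → to-witness-T (s u v)
    ; undirected = λ {u} {v} → same (matrix-symmetric x y z u v)
    }
  where
  s = matrix x y z

  same : ∀ {c c′ : Maybe Colour} → c ≡ c′ →
         ∀ e e′ → to-witness-T c e ≡ to-witness-T c′ e′
  same {just _} refl _ _ = refl

entry-tri : ∀ x y z u v → entry (tri x y z) u v ≡ matrix x y z u v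
entry-tri x y z u v = label-witness (matrix x y z u v)
  where
  label-witness : ∀ c → label (is-just c) (to-witness-T c) ≡ c
  label-witness (just _) = refl
  label-witness nothing  = refl

tri-≅ : ∀ {n} {K : ColouredGraph n} (σ : Fin 3 ↔ Fin n) → ∀ {x y z} →
        entry K (Inverse.to σ 0F) (Inverse.to σ 1F) ≡ x →
        entry K (Inverse.to σ 0F) (Inverse.to σ 2F) ≡ y →
        entry K (Inverse.to σ 1F) (Inverse.to σ 2F) ≡ z → tri x y z ≅ K
tri-≅ {K = K} σ {x} {y} {z} p q r = fromEntries σ λ u v → trans (entry-tri x y z u v) (eq u v)
  where
  open Inverse σ
  eq : ∀ u v → matrix x y z u v ≡ entry K (to u) (to v)
  eq 0F 0F = sym (entry-diagonal K _)
  eq 0F 1F = sym p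
  eq 0F 2F = sym q
  eq 1F 0F = trans (sym p) (entry-symmetric K _ _)
  eq 1F 1F = sym (entry-diagonal K _)
  eq 1F 2F = sym r
  eq 2F 0F = trans (sym q) (entry-symmetric K _ _)
  eq 2F 1F = trans (sym r) (entry-symmetric K _ _)
  eq 2F 2F = sym (entry-diagonal K _)

permutation : (f g : Vec (Fin 3) 3) → {True (all? λ u → lookup f (lookup g u) Fin.≟ u)} →
              {True (all? λ u → lookup g (lookup f u) Fin.≟ u)} → Fin 3 ↔ Fin 3
permutation f g {fg} {gf} = mk↔ₛ′ (lookup f) (lookup g) (toWitness fg) (toWitness gf)

identity swap₀₁ swap₁₂ swap₀₂ rotate rotate⁻¹ : Fin 3 ↔ Fin 3
identity = permutation (0F ∷ 1F ∷ 2F ∷ []) (0F ∷ 1F ∷ 2F ∷ [])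
swap₀₁   = permutation (1F ∷ 0F ∷ 2F ∷ []) (1F ∷ 0F ∷ 2F ∷ [])
swap₁₂   = permutation (0F ∷ 2F ∷ 1F ∷ []) (0F ∷ 2F ∷ 1F ∷ [])
swap₀₂   = permutation (2F ∷ 1F ∷ 0F ∷ []) (2F ∷ 1F ∷ 0F ∷ [])
rotate   = permutation (1F ∷ 2F ∷ 0F ∷ []) (2F ∷ 0F ∷ 1F ∷ [])
rotate⁻¹ = permutation (2F ∷ 0F ∷ 1F ∷ []) (1F ∷ 2F ∷ 0F ∷ [])

-- The clauses speak of increasing triples only, while an embedding may list its vertices in any
-- order. Injectivity rules out equalities; of the eight patterns of strict comparisons, six are the
-- permutations and two are cyclic, hence impossible.
sorting : ∀ {n} (ι : Fin 3 ↣ Fin n) → let ι[_] = Injection.to ι in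
          ∃[ σ ] let σ[_] = Inverse.to {From = setoid (Fin 3)} {setoid (Fin 3)} σ in
            ι[ σ[ 0F ] ] Fin.< ι[ σ[ 1F ] ] × ι[ σ[ 0F ] ] Fin.< ι[ σ[ 2F ] ] ×
            ι[ σ[ 1F ] ] Fin.< ι[ σ[ 2F ] ]
sorting ι with <-cmp (to 0F) (to 1F) | <-cmp (to 0F) (to 2F) | <-cmp (to 1F) (to 2F)
  where open Injection ι using (to)
... | tri≈ _ eq _ | _ | _ = contradiction (Injection.injective ι eq) λ ()
... | _ | tri≈ _ eq _ | _ = contradiction (Injection.injective ι eq) λ ()
... | _ | _ | tri≈ _ eq _ = contradiction (Injection.injective ι eq) λ ()
... | tri< a _ _ | tri< b _ _ | tri< c _ _ = identity , a , b , c
... | tri< a _ _ | tri< b _ _ | tri> _ _ c = swap₁₂ , b , a , c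
... | tri< a _ _ | tri> _ _ b | tri> _ _ c = rotate⁻¹ , b , c , a
... | tri< a _ _ | tri> _ _ b | tri< c _ _ =
  contradiction (ℕ.<-trans (ℕ.<-trans a c) b) (ℕ.<-irrefl refl)
... | tri> _ _ a | tri< b _ _ | tri< c _ _ = swap₀₁ , a , c , b
... | tri> _ _ a | tri> _ _ b | tri< c _ _ = rotate , c , a , b
... | tri> _ _ a | tri> _ _ b | tri> _ _ c = swap₀₂ , c , b , a
... | tri> _ _ a | tri< b _ _ | tri> _ _ c =
  contradiction (ℕ.<-trans (ℕ.<-trans b c) a) (ℕ.<-irrefl refl)

-- Forbidden colourings of a triple

paint : Bool → Colour
paint true  = red
paint false = blue

-- At a non-edge the bit is a dummy, so that every triple has three bits whatever its number of
-- edges.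
slot : Bool → Bool → Maybe Colour
slot e x = label e λ _ → paint x

Forbidden : List (ColouredGraph 3) → (a b c x y z : Bool) → Set
Forbidden 𝓕 a b c x y z = tri (slot a x) (slot b y) (slot c z) ∈≅ 𝓕

forbidden : List (ColouredGraph 3) → (a b c x y z : Bool) → Bool
forbidden 𝓕 a b c x y z = does (tri (slot a x) (slot b y) (slot c z) ∈≅? 𝓕)

Stable : (Bool → Bool → Bool → Set) → Set
Stable P = ∀ x y z → P x y z → P (not x) y z ⊎ P x (not y) z ⊎ P x y (not z)

Tri : (p q r : Colour) → ColouredGraph 3
Tri p q r = tri (just p) (just q) (just r)

Tri-≅ : ∀ {p q r K} (σ : Fin 3 ↔ Fin 3) →
        entry K (Inverse.to σ 0F) (Inverse.to σ 1F) ≡ just p →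
        entry K (Inverse.to σ 0F) (Inverse.to σ 2F) ≡ just q →
        entry K (Inverse.to σ 1F) (Inverse.to σ 2F) ≡ just r → Tri p q r ≅ K
Tri-≅ {K = K} σ = tri-≅ {K = K} σ

Tri∈triangles : ∀ p q r → Tri p q r ∈≅ triangles
Tri∈triangles red  red  red  = here (Tri-≅ identity refl refl refl)
Tri∈triangles blue blue blue = there (here (Tri-≅ identity refl refl refl))
Tri∈triangles red  red  blue = there (there (here (Tri-≅ identity refl refl refl)))
Tri∈triangles red  blue red  = there (there (here (Tri-≅ swap₀₁ refl refl refl)))
Tri∈triangles blue red  red  = there (there (here (Tri-≅ swap₀₂ refl refl refl)))
Tri∈triangles red  blue blue = there (there (there (here (Tri-≅ identity refl refl refl))))
Tri∈triangles blue red  blue = there (there (there (here (Tri-≅ swap₁₂ refl refl refl))))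
Tri∈triangles blue blue red  = there (there (there (here (Tri-≅ swap₀₂ refl refl refl))))

-- What the triangles of (c), and likewise those of (d), have in common: two edges of colour p meet
-- at a vertex, and the edge opposite to it is free.
Hub : ∀ {n} → Colour → ColouredGraph n → Set
Hub p H = ∃[ u ] ∀ v → u ≢ v → entry H u v ≡ just p

Hub-resp : ∀ {m n p} {H : ColouredGraph m} {K : ColouredGraph n} → H ≅ K → Hub p K → Hub p H
Hub-resp {K = K} i (u , monochrome) = from u , λ v u≢v →
  trans (entries i (from u) v)
    (trans (cong (λ w → entry K w (to v)) (strictlyInverseˡ u))
      (monochrome (to v) λ u≡ → u≢v (trans (cong from u≡) (strictlyInverseʳ v))))
  where open Inverse (_≅_.vertices i)

-- The disjuncts are ordered by the edge opposite to the hub, which is the slot that `Stable` will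
-- change.
hub-pair : ∀ {p x y z} → Hub p (Tri x y z) → (y ≡ p × z ≡ p) ⊎ (x ≡ p × z ≡ p) ⊎ (x ≡ p × y ≡ p)
hub-pair (0F , mono) with mono 1F (λ ()) | mono 2F (λ ())
... | refl | refl = inj₂ (inj₂ (refl , refl))
hub-pair (1F , mono) with mono 0F (λ ()) | mono 2F (λ ())
... | refl | refl = inj₂ (inj₁ (refl , refl))
hub-pair (2F , mono) with mono 0F (λ ()) | mono 1F (λ ())
... | refl | refl = inj₁ (refl , refl)

module _ {𝓕 𝓣 : List (ColouredGraph 3)} {p} (are : TrianglesOf 𝓕 Are 𝓣)
         (hub : All (Hub p) 𝓣) (pair : ∀ t → Tri p p t ∈≅ 𝓣) where

  ∈𝓣⇒hub : ∀ {H} → H ∈≅ 𝓣 → Hub p H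
  ∈𝓣⇒hub = All.lookupWith (λ { h i → Hub-resp i h }) hub

  pair∈𝓕 : ∀ {H} t → H ≅ Tri p p t → H ∈≅ 𝓕
  pair∈𝓕 t i = proj₂ (Equivalence.from (are _) (∈≅-resp i (pair t)))

  -- The hub of a forbidden triangle survives a change of the opposite edge, and by `pair` two edges
  -- of colour p make a triangle forbidden whatever the third one is.
  hub-stable : Stable (Forbidden 𝓕 true true true)
  hub-stable x y z forb
    with hub-pair (∈𝓣⇒hub (Equivalence.to (are _) (Tri∈triangles (paint x) (paint y) (paint z) , forb)))
  ... | inj₁ (y≡p , z≡p) = inj₁ (pair∈𝓕 _
    (Tri-≅ swap₀₂ refl (cong just (sym y≡p)) (cong just (sym z≡p))))
  ... | inj₂ (inj₁ (x≡p , z≡p)) = inj₂ (inj₁ (pair∈𝓕 _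
    (Tri-≅ swap₀₁ (cong just (sym x≡p)) refl (cong just (sym z≡p)))))
  ... | inj₂ (inj₂ (x≡p , y≡p)) = inj₂ (inj₂ (pair∈𝓕 _
    (Tri-≅ identity (cong just (sym x≡p)) (cong just (sym y≡p)) refl)))

stable : ∀ {𝓕} →
  TrianglesOf 𝓕 Are [] ⊎ All (_∈≅ 𝓕) triangles ⊎
  TrianglesOf 𝓕 Are (rK₃ ∷ rrbK₃ ∷ []) ⊎ TrianglesOf 𝓕 Are (bK₃ ∷ rbbK₃ ∷ []) →
  ∀ a b c → Stable (Forbidden 𝓕 a b c)
-- At a non-edge `slot` drops the bit, so both patterns are the same graph and `forb` proves the
-- changed one as it stands.
stable _ false b c x y z forb = inj₁ forb
stable _ true false c x y z forb = inj₂ (inj₁ forb)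
stable _ true true false x y z forb = inj₂ (inj₂ forb)
stable (inj₁ none) true true true x y z forb
  with Equivalence.to (none _) (Tri∈triangles (paint x) (paint y) (paint z) , forb)
... | ()
stable (inj₂ (inj₁ every)) true true true x y z forb =
  inj₁ (All.lookupWith (λ { K∈𝓕 i → ∈≅-resp i K∈𝓕 }) every
         (Tri∈triangles (paint (not x)) (paint y) (paint z)))
stable (inj₂ (inj₂ (inj₁ are))) true true true =
  hub-stable are ((0F , star) ∷ (0F , star′) ∷ []) λ where
    red  → here (Tri-≅ identity refl refl refl)
    blue → there (here (Tri-≅ identity refl refl refl))
  where
  star : ∀ v → 0F ≢ v → entry rK₃ 0F v ≡ just red
  star 0F 0≢0 = contradiction refl 0≢0
  star 1F _   = refl
  star 2F _   = refl
  star′ : ∀ v → 0F ≢ v → entry rrbK₃ 0F v ≡ just red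
  star′ 0F 0≢0 = contradiction refl 0≢0
  star′ 1F _   = refl
  star′ 2F _   = refl
stable (inj₂ (inj₂ (inj₂ are))) true true true =
  hub-stable are ((2F , star) ∷ (2F , star′) ∷ []) λ where
    blue → here (Tri-≅ identity refl refl refl)
    red  → there (here (Tri-≅ swap₀₂ refl refl refl))
  where
  star : ∀ v → 2F ≢ v → entry bK₃ 2F v ≡ just blue
  star 2F 2≢2 = contradiction refl 2≢2
  star 0F _   = refl
  star 1F _   = refl
  star′ : ∀ v → 2F ≢ v → entry rbbK₃ 2F v ≡ just blue
  star′ 2F 2≢2 = contradiction refl 2≢2
  star′ 0F _   = refl
  star′ 1F _   = refl

-- The two-literal clauses of one triple

LocalClause : Set
LocalClause = (Bool × Fin 3) × (Bool × Fin 3)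

Holds : (Fin 3 → Bool) → LocalClause → Set
Holds val ((s , i) , (t , j)) = val i ≡ s ⊎ val j ≡ t

singleton-if : ∀ {A : Set} → Bool → A → List A
singleton-if b x = if b then [ x ] else []

bools : List Bool
bools = true ∷ false ∷ []

-- Each summand treats one pair of slots and quantifies over the third. One-edge and edgeless
-- patterns are covered through the dummies: the clauses for both values of a dummy together forbid
-- the real bit, and with three dummies all twelve clauses together are contradictory.
exclusions : (Bool → Bool → Bool → Bool) → Bool → Bool → List LocalClause
exclusions g x y =
  singleton-if (g x y true ∧ g x y false) ((not x , 0F) , (not y , 1F)) ++
  singleton-if (g x true y ∧ g x false y) ((not x , 0F) , (not y , 2F)) ++
  singleton-if (g true x y ∧ g false x y) ((not x , 1F) , (not y , 2F))

constraints : (Bool → Bool → Bool → Bool) → List LocalClause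
constraints g = concatMap (λ x → concatMap (exclusions g x) bools) bools

module _ {A : Set} {P : A → Set} where

  singleton-if⁺ : ∀ {b x} → (b ≡ true → P x) → All P (singleton-if b x)
  singleton-if⁺ {true}  p = p refl ∷ []
  singleton-if⁺ {false} p = []

  singleton-if⁻ : ∀ {b x} → All P (singleton-if b x) → b ≡ true → P x
  singleton-if⁻ (p ∷ []) refl = p

  concat-bools⁺ : ∀ (f : Bool → List A) → (∀ b → All P (f b)) → All P (concatMap f bools)
  concat-bools⁺ f p = All.++⁺ (p true) (All.++⁺ (p false) [])

  concat-bools⁻ : ∀ (f : Bool → List A) → All P (concatMap f bools) → ∀ b → All P (f b)
  concat-bools⁻ f ps true  = All.++⁻ˡ (f true) ps
  concat-bools⁻ f ps false = All.++⁻ˡ (f false) (All.++⁻ʳ (f true) ps)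

≡⊎≡not : ∀ a b → a ≡ b ⊎ a ≡ not b
≡⊎≡not true  true  = inj₁ refl
≡⊎≡not true  false = inj₂ refl
≡⊎≡not false true  = inj₂ refl
≡⊎≡not false false = inj₁ refl

∧-both : ∀ (h : Bool → Bool) → h true ∧ h false ≡ true → ∀ b → h b ≡ true
∧-both h eq b with h true in p | h false in q
∧-both h refl true  | true | true = p
∧-both h refl false | true | true = q

both-∧ : ∀ (h : Bool → Bool) b → h b ≡ true → h (not b) ≡ true → h true ∧ h false ≡ true
both-∧ h true  p q rewrite p | q = refl
both-∧ h false p q rewrite p | q = refl

module _ (g : Bool → Bool → Bool → Bool) (val : Fin 3 → Bool) where

  -- A violated clause would say that both extensions of a pair of colours are forbidden, and the
  -- actual triple is one of the two.
  constraints-hold : g (val 0F) (val 1F) (val 2F) ≢ true → All (Holds val) (constraints g)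
  constraints-hold allowed = concat-bools⁺ _ λ x → concat-bools⁺ (exclusions g x) λ y →
    All.++⁺ (singleton-if⁺ (clause (λ x y z → g x y z) allowed x y))
      (All.++⁺ (singleton-if⁺ (clause (λ x y z → g x z y) allowed x y))
               (singleton-if⁺ (clause (λ x y z → g z x y) allowed x y)))
    where
    -- Here h is g with the slot to be extended moved to the last place.
    clause : (h : Bool → Bool → Bool → Bool) → ∀ {u v w} → h u v w ≢ true →
             ∀ x y → h x y true ∧ h x y false ≡ true → u ≡ not x ⊎ v ≡ not y
    clause h {u} {v} {w} allowed x y both with ≡⊎≡not u x | ≡⊎≡not v y
    ... | inj₂ p    | _         = inj₁ p
    ... | inj₁ _    | inj₂ q    = inj₂ q
    ... | inj₁ refl | inj₁ refl = contradiction (∧-both (h u v) both w) allowed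

  -- Stability turns one forbidden triple into two that differ in a single slot; the clause on the
  -- other two slots then excludes the very colours they have.
  constraints-exclude : Stable (λ x y z → g x y z ≡ true) → All (Holds val) (constraints g) →
                        g (val 0F) (val 1F) (val 2F) ≢ true
  constraints-exclude stable hold bad = excluded (stable _ _ _ bad)
    where
    x = val 0F
    y = val 1F
    z = val 2F

    held : ∀ u v → All (Holds val) (exclusions g u v)
    held u v = concat-bools⁻ (exclusions g u)
      (concat-bools⁻ (λ u → concatMap (exclusions g u) bools) hold u) v

    absurd : ∀ {a b : Bool} → a ≡ not a ⊎ b ≡ not b → ⊥
    absurd (inj₁ eq) = not-¬ refl eq
    absurd (inj₂ eq) = not-¬ refl eq

    excluded : g (not x) y z ≡ true ⊎ g x (not y) z ≡ true ⊎ g x y (not z) ≡ true → ⊥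
    excluded (inj₁ bad′) = absurd (singleton-if⁻
      (All.++⁻ʳ (singleton-if (g y true z ∧ g y false z) _)
        (All.++⁻ʳ (singleton-if (g y z true ∧ g y z false) _) (held y z)))
      (both-∧ (λ b → g b y z) x bad bad′))
    excluded (inj₂ (inj₁ bad′)) = absurd (singleton-if⁻
      (All.++⁻ˡ (singleton-if (g x true z ∧ g x false z) _)
        (All.++⁻ʳ (singleton-if (g x z true ∧ g x z false) _) (held x z)))
      (both-∧ (λ b → g x b z) y bad bad′))
    excluded (inj₂ (inj₂ bad′)) = absurd (singleton-if⁻
      (All.++⁻ˡ (singleton-if (g x y true ∧ g x y false) _) (held x y))
      (both-∧ (g x y) z bad bad′))

-- The reduction

Cell : Set
Cell = Maybe Bool

localClauses : (Bool → Bool → Bool → List LocalClause) → (a b c : Cell) → List LocalClause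
localClauses K (just a) (just b) (just c) = K a b c
localClauses K _        _        _        = []

globalise : (Fin 3 → ℕ) → LocalClause → Clause
globalise pos ((s , i) , (t , j)) = literal s (pos i) , literal t (pos j)

triple : {A : Set} → A → A → A → Fin 3 → A
triple x y z 0F = x
triple x y z 1F = y
triple x y z 2F = z

-- New clauses go in front because the output grows to the left; hence `formula` is a left fold over
-- the triples in the order of the visits.
extend : (Bool → Bool → Bool → List LocalClause) → (a b c : Cell) (p q r : ℕ) → 2-CNF → 2-CNF
extend K a b c p q r φ = map (globalise (triple p q r)) (localClauses K a b c) ++ φ

-- The number of cells between the left `$` and the cell (u, v): one separator, then u rows of n
-- cells with a separator each, then v cells.
var⟨_,_⟩ : ∀ {n} → Fin n → Fin n → ℕ
var⟨_,_⟩ {n} u v = suc (toℕ u * suc n + toℕ v)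

-- In base `suc n` the lower digit is v, so `Fin.combine` applies once v is seen in `Fin (suc n)`;
-- the digit n belongs to the separator that ends a row.
var-injective : ∀ {n} {u v u′ v′ : Fin n} → var⟨ u , v ⟩ ≡ var⟨ u′ , v′ ⟩ → u ≡ u′ × v ≡ v′
var-injective {n} {u} {v} {u′} {v′} eq = proj₁ both , Fin.inject₁-injective (proj₂ both)
  where
  position : ∀ (u v : Fin n) → toℕ (Fin.combine u (Fin.inject₁ v)) ≡ toℕ u * suc n + toℕ v
  position u v = trans (Fin.toℕ-combine u (Fin.inject₁ v))
                       (cong₂ _+_ (ℕ.*-comm (suc n) (toℕ u)) (Fin.toℕ-inject₁ v))

  both = Fin.combine-injective u (Fin.inject₁ v) u′ (Fin.inject₁ v′)
    (Fin.toℕ-injective (trans (position u v) (trans (ℕ.suc-injective eq) (sym (position u′ v′)))))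

-- Only the cells above the diagonal carry information, so that a triple
-- of them is visited once, in increasing order of its vertices.

cell : ∀ {n} → Graph n → Fin n → Fin n → Cell
cell G u v = if toℕ u <ᵇ toℕ v then just (adjacent G u v) else nothing

<⇒<ᵇ≡true : ∀ {m n} → m < n → (m <ᵇ n) ≡ true
<⇒<ᵇ≡true {m} {n} m<n with m <ᵇ n | ℕ.<⇒<ᵇ m<n
... | true | _ = refl

≮⇒<ᵇ≡false : ∀ {m n} → ¬ m < n → (m <ᵇ n) ≡ false
≮⇒<ᵇ≡false {m} {n} m≮n with m <ᵇ n in eq
... | false = refl
... | true  = contradiction (ℕ.<ᵇ⇒< m n (subst T (sym eq) tt)) m≮n

cell-above : ∀ {n} (G : Graph n) {u v : Fin n} → u Fin.< v → cell G u v ≡ just (adjacent G u v)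
cell-above G u<v rewrite <⇒<ᵇ≡true u<v = refl

cell-below : ∀ {n} (G : Graph n) {u v : Fin n} → ¬ u Fin.< v → cell G u v ≡ nothing
cell-below G u≮v rewrite ≮⇒<ᵇ≡false u≮v = refl

module Reduce (K : Bool → Bool → Bool → List LocalClause) {n} (G : Graph n) where

  addTriple : Fin n → Fin n → 2-CNF → Fin n → 2-CNF
  addTriple u v φ w =
    extend K (cell G u v) (cell G u w) (cell G v w) var⟨ u , v ⟩ var⟨ u , w ⟩ var⟨ v , w ⟩ φ

  addPair : Fin n → 2-CNF → Fin n → 2-CNF
  addPair u φ v = foldl (addTriple u v) φ (allFin n)

  addVertex : 2-CNF → Fin n → 2-CNF
  addVertex φ u = foldl (addPair u) φ (allFin n)

  formula : 2-CNF
  formula = foldl addVertex [] (allFin n)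

  module _ (ν : ℕ → Bool) where

    val : (u v w : Fin n) → Fin 3 → Bool
    val u v w i = ν (triple var⟨ u , v ⟩ var⟨ u , w ⟩ var⟨ v , w ⟩ i)

    TripleHolds : (u v w : Fin n) → Set
    TripleHolds u v w = u Fin.< v → u Fin.< w → v Fin.< w →
      All (Holds (val u v w)) (K (adjacent G u v) (adjacent G u w) (adjacent G v w))

    module _ {A : Set} (h : 2-CNF → A → 2-CNF) {Q : A → Set} where

      foldl⁺ : (∀ φ x → Q x → Satisfies ν φ → Satisfies ν (h φ x)) →
               ∀ φ {xs} → All Q xs → Satisfies ν φ → Satisfies ν (foldl h φ xs)
      foldl⁺ step φ []       sat = sat
      foldl⁺ step φ (q ∷ qs) sat = foldl⁺ step (h φ _) qs (step φ _ q sat)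

      foldl⁻ : (∀ φ x → Satisfies ν (h φ x) → Q x × Satisfies ν φ) →
               ∀ φ xs → Satisfies ν (foldl h φ xs) → All Q xs × Satisfies ν φ
      foldl⁻ step φ []       sat = [] , sat
      foldl⁻ step φ (x ∷ xs) sat =
        let qs , sat′ = foldl⁻ step (h φ x) xs sat
            q  , sat″ = step φ x sat′
        in q ∷ qs , sat″

    formula⁺ : (∀ u v w → TripleHolds u v w) → Satisfies ν formula
    formula⁺ holds =
      foldl⁺ addVertex (λ φ u holds →
          foldl⁺ (addPair u) (λ φ v holds →
              foldl⁺ (addTriple u v) (λ φ w holds → All.++⁺ (All.map⁺ (local u v w holds)))
                φ (All.universal holds (allFin n)))
            φ (All.universal holds (allFin n)))
        [] (All.universal holds (allFin n)) []
      where
      local : ∀ u v w → TripleHolds u v w →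
              All (Holds (val u v w)) (localClauses K (cell G u v) (cell G u w) (cell G v w))
      local u v w h with u Fin.<? v | u Fin.<? w | v Fin.<? w
      ... | yes a | yes b | yes c
        rewrite cell-above G a | cell-above G b | cell-above G c = h a b c
      ... | no ¬a | _ | _ rewrite cell-below G ¬a = []
      ... | yes a | no ¬b | _ rewrite cell-above G a | cell-below G ¬b = []
      ... | yes a | yes b | no ¬c
        rewrite cell-above G a | cell-above G b | cell-below G ¬c = []

    formula⁻ : Satisfies ν formula → ∀ u v w → TripleHolds u v w
    formula⁻ sat u v w = All.lookup (All.lookup (All.lookup
      (proj₁ (foldl⁻ addVertex (λ φ u →
                foldl⁻ (addPair u) (λ φ v →
                  foldl⁻ (addTriple u v) (λ φ w → step u v w φ) φ (allFin n)) φ (allFin n))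
              [] (allFin n) sat))
      (∈-allFin u)) (∈-allFin v)) (∈-allFin w)
      where
      step : ∀ u v w φ → Satisfies ν (addTriple u v φ w) → TripleHolds u v w × Satisfies ν φ
      step u v w φ sat = holds , All.++⁻ʳ (map _ local) sat
        where
        local = localClauses K (cell G u v) (cell G u w) (cell G v w)
        holds : TripleHolds u v w
        holds a b c with hs ← All.map⁻ {xs = local} (All.++⁻ˡ (map _ local) sat)
          rewrite cell-above G a | cell-above G b | cell-above G c = hs

-- Free colourings and satisfying assignments

module _ (𝓕 : List (ColouredGraph 3)) where

  clauses : Bool → Bool → Bool → List LocalClause
  clauses a b c = constraints (forbidden 𝓕 a b c)

  witness : ∀ {P : Set} (P? : Dec P) → does P? ≡ true → P
  witness (yes p) _ = p

  module _ {n} (G : Graph n) where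

    open Reduce clauses G

    free⇒satisfiable : ∀ (c : Colouring G) → Free 𝓕 (G , c) → ∃[ ν ] Satisfies ν formula
    free⇒satisfiable c free = ν , formula⁺ ν λ u v w u<v u<w v<w →
      constraints-hold (forbidden 𝓕 _ _ _) (val ν u v w) λ bad →
        let ι = record { to = triple u v w ; cong = cong _ ; injective = distinct u<v u<w v<w } in
        free ι (∈≅-resp (≅-sym (tri-≅ {K = induced (G , c) ι} identity
          (entry-ν u v) (entry-ν u w) (entry-ν v w))) (witness (_ ∈≅? 𝓕) bad))
      where
      distinct : ∀ {u v w : Fin n} → u Fin.< v → u Fin.< w → v Fin.< w →
                 ∀ {i j} → triple u v w i ≡ triple u v w j → i ≡ j
      distinct a b c {0F} {0F} eq = refl
      distinct a b c {0F} {1F} eq = contradiction eq (Fin.<⇒≢ a)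
      distinct a b c {0F} {2F} eq = contradiction eq (Fin.<⇒≢ b)
      distinct a b c {1F} {0F} eq = contradiction (sym eq) (Fin.<⇒≢ a)
      distinct a b c {1F} {1F} eq = refl
      distinct a b c {1F} {2F} eq = contradiction eq (Fin.<⇒≢ c)
      distinct a b c {2F} {0F} eq = contradiction (sym eq) (Fin.<⇒≢ b)
      distinct a b c {2F} {1F} eq = contradiction (sym eq) (Fin.<⇒≢ c)
      distinct a b c {2F} {2F} eq = refl

      red? : ∀ u v → Dec (entry (G , c) u v ≡ just red)
      red? u v = Maybe.≡-dec _≟ᶜ_ _ _

      -- Variable numbers are never decoded: k is true when some red pair is named k. By
      -- `var-injective` there is only one candidate, and a non-edge gets false.
      named? : ∀ k → Dec (∃[ u ] ∃[ v ] var⟨ u , v ⟩ ≡ k × entry (G , c) u v ≡ just red)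
      named? k = any? λ u → any? λ v → (var⟨ u , v ⟩ ℕ.≟ k) ×-dec red? u v

      ν : ℕ → Bool
      ν k = does (named? k)

      label-slot : ∀ b f → label b f ≡ slot b (does (Maybe.≡-dec _≟ᶜ_ (label b f) (just red)))
      label-slot false f = refl
      label-slot true  f with f tt
      ... | red  = refl
      ... | blue = refl

      entry-ν : ∀ u v → entry (G , c) u v ≡ slot (adjacent G u v) (ν var⟨ u , v ⟩)
      entry-ν u v = trans (label-slot (adjacent G u v) (colour c)) (cong (slot _)
        (does-⇔ (mk⇔ (λ isRed → u , v , refl , isRed) unname) (red? u v) (named? var⟨ u , v ⟩)))
        where
        unname : (∃[ u′ ] ∃[ v′ ] var⟨ u′ , v′ ⟩ ≡ var⟨ u , v ⟩ × entry (G , c) u′ v′ ≡ just red) →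
                 entry (G , c) u v ≡ just red
        unname (u′ , v′ , eq , isRed) with var-injective {u = u′} {v′} {u} {v} eq
        ... | refl , refl = isRed

    satisfiable⇒free : (∀ a b c → Stable (Forbidden 𝓕 a b c)) →
                       ∃[ ν ] Satisfies ν formula → ∃[ c ] Free 𝓕 (G , c)
    satisfiable⇒free stab (ν , sat) = c , free
      where
      -- Ordering the two vertices makes the colouring symmetric, and for distinct vertices only
      -- variables above the diagonal are read, those that the clauses constrain.
      κ : Fin n → Fin n → Bool
      κ u v = ν (suc ((toℕ u ⊓ toℕ v) * suc n + (toℕ u ⊔ toℕ v)))

      c : Colouring G
      c = record
        { colour     = λ {u} {v} _ → paint (κ u v)
        ; undirected = λ {u} {v} _ _ → cong₂ (λ p q → paint (ν (suc (p * suc n + q))))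
                         (ℕ.⊓-comm (toℕ u) (toℕ v)) (ℕ.⊔-comm (toℕ u) (toℕ v))
        }

      entry-κ : ∀ {u v} → u Fin.< v → entry (G , c) u v ≡ slot (adjacent G u v) (ν var⟨ u , v ⟩)
      entry-κ u<v = cong₂ (λ p q → slot _ (ν (suc (p * suc n + q))))
        (ℕ.m≤n⇒m⊓n≡m (ℕ.<⇒≤ u<v)) (ℕ.m≤n⇒m⊔n≡n (ℕ.<⇒≤ u<v))

      stab′ : ∀ a b c → Stable (λ x y z → forbidden 𝓕 a b c x y z ≡ true)
      stab′ a b c x y z bad with stab a b c x y z (witness (_ ∈≅? 𝓕) bad)
      ... | inj₁ bad′        = inj₁ (dec-true (_ ∈≅? 𝓕) bad′)
      ... | inj₂ (inj₁ bad′) = inj₂ (inj₁ (dec-true (_ ∈≅? 𝓕) bad′))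
      ... | inj₂ (inj₂ bad′) = inj₂ (inj₂ (dec-true (_ ∈≅? 𝓕) bad′))

      free : Free 𝓕 (G , c)
      free ι ∈𝓕 with sorting ι
      ... | σ , u<v , u<w , v<w =
        constraints-exclude (forbidden 𝓕 _ _ _) (val ν (ισ 0F) (ισ 1F) (ισ 2F)) (stab′ _ _ _)
          (formula⁻ ν sat _ _ _ u<v u<w v<w)
          (dec-true (_ ∈≅? 𝓕) (∈≅-resp
            (tri-≅ {K = induced (G , c) ι} σ (entry-κ u<v) (entry-κ u<w) (entry-κ v<w)) ∈𝓕))
        where
        ισ : Fin 3 → Fin n
        ισ i = Injection.to ι (Inverse.to σ i)

-- The reducing machine

-- The tapes are the input, the output, a counter holding the vertices, and
-- three copies of the matrix, each of the form $ ♯ row ♯ row ♯ ... ♯ row ♯ $.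
-- A cell ▪ is one on or below the diagonal.

Sym : Set
Sym = Symbol 4

pattern 𝟙 = bit true
pattern ▪ = work 0F
pattern ♯ = work 1F
pattern $ = work 2F
pattern ✗ = work 3F

isOne isBit isSeparator isEnd isMark : Sym → Bool
isOne 𝟙 = true
isOne _ = false
isBit (bit _) = true
isBit _       = false
isSeparator ♯ = true
isSeparator _ = false
isEnd $ = true
isEnd _ = false
isMark ✗ = true
isMark _ = false


open Programs 4 6

-- Forms that the results of `move` take without a case split on whether a list is empty; beyond an
-- empty list lies a blank.
at back : List Sym → List Sym → Tape 4
at ls []       = tape ls blank []
at ls (r ∷ rs) = tape ls r rs

back []       rs = tape [] blank rs
back (l ∷ ls) rs = tape ls l rs

move-right : ∀ ls {a} rs → move right (tape ls a rs) ≡ at (a ∷ ls) rs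
move-right ls []       = refl
move-right ls (r ∷ rs) = refl

move-left : ∀ ls {a} rs → move left (tape ls a rs) ≡ back ls (a ∷ rs)
move-left []       rs = refl
move-left (l ∷ ls) rs = refl

-- The output is written from right to left, so that writing a bit prepends
-- it to the output.

outTape : List Bool → Tape 4
outTape w = tape [] blank (map bit w)

-- The head waits on the blank to the left of the word, so a single move to the right makes the
-- output readable at the end.
read-output : ∀ w → read (move right (outTape w)) ≡ w
read-output []      = refl
read-output (b ∷ w) = cong (b ∷_) (readBits-bits w)
  where
  readBits-bits : ∀ w → readBits {4} (map bit w) ≡ w
  readBits-bits []      = refl
  readBits-bits (b ∷ w) = cong (b ∷_) (readBits-bits w)

all-ʳ++ : ∀ {A : Set} {P : A → Set} {xs ys : List A} → All P xs → All P ys → All P (xs ʳ++ ys)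
all-ʳ++ []       qs = qs
all-ʳ++ (p ∷ ps) qs = all-ʳ++ ps (p ∷ qs)

-- Sweeping over a tape

-- Built like the bounds of `runs-stop` and `runs-again`, so that inductions over a loop need no
-- arithmetic.
loopTime : ℕ → ℕ → ℕ
loopTime b zero    = 1
loopTime b (suc k) = suc (b + loopTime b k)

loopTime-mono : ∀ {b c j k} → b ≤ c → j ≤ k → loopTime b j ≤ loopTime c k
loopTime-mono {k = zero}  b≤c z≤n       = ℕ.≤-refl
loopTime-mono {k = suc k} b≤c z≤n       = s≤s z≤n
loopTime-mono             b≤c (s≤s j≤k) = s≤s (ℕ.+-mono-≤ b≤c (loopTime-mono b≤c j≤k))

emit : Maybe Bool → List Bool → List Bool
emit nothing  w = w
emit (just b) w = b ∷ w

emits : Maybe Bool → ℕ → List Bool → List Bool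
emits nothing  k w = w
emits (just b) k w = replicate k b ++ w

-- The bits of a sweep are all equal, so the one written first may be counted as the last.
emits-suc : ∀ o k w → emits o k (emit o w) ≡ emits o (suc k) w
emits-suc nothing  k       w = refl
emits-suc (just b) zero    w = refl
emits-suc (just b) (suc k) w = cong (b ∷_) (emits-suc (just b) k w)

emitting : Maybe Bool → Sym → Sym × Move
emitting nothing  a = keep a
emitting (just b) _ = bit b , left

-- The index i counts from the third tape on: 0F is the counter, and 1F, 2F, 3F are the matrix tapes
-- for uv, uw and vw.
onTape : Fin 4 → Maybe Bool → (Sym → Sym × Move) → Program
onTape i o g = perform λ where
  (x ∷ y ∷ s) → keep x ∷ emitting o y ∷ Vec.updateAt (Vec.map keep s) i (λ (a , _) → g a)

until : Fin 4 → (Sym → Bool) → Heads → Bool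
until i P (_ ∷ _ ∷ s) = not (P (lookup s i))

sweep : Fin 4 → Move → (Sym → Bool) → Maybe Bool → Program
sweep i d P o = while (until i P) (onTape i o (_, d))

module _ {I : Tape 4} where

  -- `insertAt R i t` separates the tape that moves from the other three; once i is a concrete index
  -- and R is spelled out, both sides compute.
  runs-onTape : ∀ i o {g w t} {R : Vec (Tape 4) 3} →
    Runs (onTape i o g) 1 (I ∷ outTape w ∷ insertAt R i t)
                          (I ∷ outTape (emit o w) ∷ insertAt R i (act (g (head t)) t))
  runs-onTape 0F nothing  {R = _ ∷ _ ∷ _ ∷ []} = runs-perform refl
  runs-onTape 1F nothing  {R = _ ∷ _ ∷ _ ∷ []} = runs-perform refl
  runs-onTape 2F nothing  {R = _ ∷ _ ∷ _ ∷ []} = runs-perform refl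
  runs-onTape 3F nothing  {R = _ ∷ _ ∷ _ ∷ []} = runs-perform refl
  runs-onTape 0F (just b) {R = _ ∷ _ ∷ _ ∷ []} = runs-perform refl
  runs-onTape 1F (just b) {R = _ ∷ _ ∷ _ ∷ []} = runs-perform refl
  runs-onTape 2F (just b) {R = _ ∷ _ ∷ _ ∷ []} = runs-perform refl
  runs-onTape 3F (just b) {R = _ ∷ _ ∷ _ ∷ []} = runs-perform refl

  until-head : ∀ i P O t (R : Vec (Tape 4) 3) →
    until i P (Vec.map head (I ∷ O ∷ insertAt R i t)) ≡ not (P (head t))
  until-head 0F P O t (_ ∷ _ ∷ _ ∷ []) = refl
  until-head 1F P O t (_ ∷ _ ∷ _ ∷ []) = refl
  until-head 2F P O t (_ ∷ _ ∷ _ ∷ []) = refl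
  until-head 3F P O t (_ ∷ _ ∷ _ ∷ []) = refl

  module _ {i : Fin 4} {R : Vec (Tape 4) 3} where

    runs-write : ∀ o {a d w t u} → move d record t { head = a } ≡ u →
      Runs (onTape i o λ _ → a , d) 1
        (I ∷ outTape w ∷ insertAt R i t) (I ∷ outTape (emit o w) ∷ insertAt R i u)
    runs-write o refl = runs-onTape i o

    runs-move : ∀ {o d w t u} → move d t ≡ u →
      Runs (onTape i o (_, d)) 1
        (I ∷ outTape w ∷ insertAt R i t) (I ∷ outTape (emit o w) ∷ insertAt R i u)
    runs-move {o} refl = runs-onTape i o

    module _ {P : Sym → Bool} {s : Sym} (stop : P s ≡ true) where

      runs-sweep-left : ∀ {o w ls rs} xs → All (λ x → P x ≡ false) xs →
        Runs (sweep i left P o) (loopTime 1 (length xs))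
             (I ∷ outTape w ∷ insertAt R i (back (xs ++ s ∷ ls) rs))
             (I ∷ outTape (emits o (length xs) w) ∷ insertAt R i (tape ls s (xs ʳ++ rs)))
      runs-sweep-left {nothing} {w} {ls} {rs} [] [] =
        runs-stop (trans (until-head i P (outTape w) (tape ls s rs) R) (cong not stop))
      runs-sweep-left {just b} {w} {ls} {rs} [] [] =
        runs-stop (trans (until-head i P (outTape w) (tape ls s rs) R) (cong not stop))
      runs-sweep-left {o} {w} {ls} {rs} (x ∷ xs) (¬P ∷ ¬Ps) =
        runs-again (trans (until-head i P (outTape w) (tape (xs ++ s ∷ ls) x rs) R) (cong not ¬P))
          (runs-move (move-left (xs ++ _) {x} rs))
          (subst (λ v → Runs (sweep i left P o) (loopTime 1 (length xs))
                   (I ∷ outTape (emit o w) ∷ insertAt R i (back (xs ++ s ∷ ls) (x ∷ rs)))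
                   (I ∷ outTape v ∷ insertAt R i (tape ls s (xs ʳ++ (x ∷ rs)))))
            (emits-suc o (length xs) w) (runs-sweep-left xs ¬Ps))

      -- The same run with the swept cells listed from left to right, as the rows of the matrix are.
      runs-sweep-back : ∀ {o w ls rs} xs → All (λ x → P x ≡ false) xs →
        Runs (sweep i left P o) (loopTime 1 (length xs))
             (I ∷ outTape w ∷ insertAt R i (back (xs ʳ++ (s ∷ ls)) rs))
             (I ∷ outTape (emits o (length xs) w) ∷ insertAt R i (tape ls s (xs ++ rs)))
      runs-sweep-back {o} {w} {ls} {rs} xs ¬Ps =
        subst₂ (λ before after →
            Runs (sweep i left P o) (loopTime 1 (length xs))
              (I ∷ outTape w ∷ insertAt R i (back before rs))
              (I ∷ outTape (emits o (length xs) w) ∷ insertAt R i (tape ls s after)))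
          (sym (ʳ++-defn xs)) (trans (ʳ++-defn (reverse xs)) (cong (_++ rs) (reverse-involutive xs)))
          (subst (λ k → Runs (sweep i left P o) (loopTime 1 k)
              (I ∷ outTape w ∷ insertAt R i (back (reverse xs ++ s ∷ ls) rs))
              (I ∷ outTape (emits o k w) ∷ insertAt R i (tape ls s (reverse xs ʳ++ rs))))
            (length-reverse xs) (runs-sweep-left (reverse xs) (all-ʳ++ ¬Ps [])))

      runs-sweep-right : ∀ {w ls rs} xs → All (λ x → P x ≡ false) xs →
        Runs (sweep i right P nothing) (loopTime 1 (length xs))
             (I ∷ outTape w ∷ insertAt R i (at ls (xs ++ s ∷ rs)))
             (I ∷ outTape w ∷ insertAt R i (tape (xs ʳ++ ls) s rs))
      runs-sweep-right {w} {ls} {rs} [] [] =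
        runs-stop (trans (until-head i P (outTape w) (tape ls s rs) R) (cong not stop))
      runs-sweep-right {w} {ls} {rs} (x ∷ xs) (¬P ∷ ¬Ps) =
        runs-again (trans (until-head i P (outTape w) (tape ls x (xs ++ s ∷ rs)) R) (cong not ¬P))
          (runs-move (move-right ls {x} (xs ++ _))) (runs-sweep-right xs ¬Ps)

Plain : Sym → Set
Plain x = isEnd x ≡ false × isMark x ≡ false

-- The cell to the right of ls is the k-th one after $.

record Position (k : ℕ) (ls : List Sym) : Set where
  constructor position
  field
    {cells}  : List Sym
    plain    : All Plain cells
    is       : ls ≡ cells ʳ++ [ $ ]
    distance : length cells ≡ k

position-first : Position 1 (♯ ∷ [ $ ])
position-first = position {cells = [ ♯ ]} ((refl , refl) ∷ []) refl refl

position-ʳ++ : ∀ {k ls} xs → All Plain xs → Position k ls → Position (length xs + k) (xs ʳ++ ls)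
position-ʳ++ {k} xs plain (position {cells} plain′ refl refl) = position (All.++⁺ plain′ plain)
  (sym (++-ʳ++ cells)) (trans (length-++ cells) (ℕ.+-comm (length cells) (length xs)))

literalTime : ℕ → ℕ
literalTime k = 1 + (loopTime 1 k + (loopTime 1 (suc k) + 1))

module _ (i : Fin 4) (b s : Bool) where

  -- The mark ✗ replaces the cell during the walk, so that the head can
  -- find it again.

  emitLiteral : Program
  emitLiteral = onTape i (just false) (λ _ → ✗ , left) ⨾ sweep i left isEnd (just true) ⨾
                sweep i right isMark nothing ⨾ onTape i (just s) (λ _ → bit b , stay)

  -- As the output grows to the left, the closing `false` of the unary name comes first, then one
  -- `true` for each cell between the mark and `$`, and the sign last. The erased bit b is known to
  -- the program, which puts it back.
  runs-emitLiteral : ∀ {I w R k ls rs} → Position k ls → let t = tape ls (bit b) rs in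
    Runs emitLiteral (literalTime k)
      (I ∷ outTape w ∷ insertAt R i t) (I ∷ outTape (encodeLiteral (literal s k) ++ w) ∷ insertAt R i t)
  runs-emitLiteral {I} {w} {R} {k} {ls} {rs} (position {xs} plain refl refl) =
    subst (λ out → Runs emitLiteral _ (I ∷ outTape w ∷ insertAt R i (tape ls (bit b) rs))
                                      (I ∷ outTape (s ∷ out) ∷ insertAt R i (tape ls (bit b) rs)))
      (sym (++-assoc (replicate (length xs) true) _ _))
      (runs-write (just false) {t = tape ls (bit b) rs} (move-left ls {✗} rs) then
       runs-sweep-back refl xs (All.map proj₁ plain) then
       runs-sweep-right refl ($ ∷ xs) (refl ∷ All.map proj₂ plain) then
       runs-write (just s) {t = tape ls ✗ rs} refl)

-- The clauses of one triple on the output tape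

idle : Program
idle = perform (Vec.map keep)

runs-idle : ∀ {ts} → Runs idle 1 ts ts
runs-idle {ts} = runs-perform (apply-keep ts)

test : (Sym → Bool) → Fin 3 → Heads → Bool
test P i (_ ∷ _ ∷ s) = P (lookup s (suc i))

-- Moves an adjacency bit from the tape into the finite control, where the clauses belonging to it
-- are hard-wired. A blotted cell ends the visit.
switch : Fin 3 → (Bool → Program) → Program
switch i p = branch (test isBit i) (branch (test isOne i) (p true) (p false)) idle

-- The second literal precedes the first, and in `emitClauses` the later clauses precede the earlier
-- ones, because output is prepended.
emitClause : (Fin 3 → Bool) → LocalClause → Program
emitClause bits ((s , i) , (t , j)) = emitLiteral (suc j) (bits j) t ⨾ emitLiteral (suc i) (bits i) s

emitClauses : (Fin 3 → Bool) → List LocalClause → Program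
emitClauses bits []       = idle
emitClauses bits (c ∷ cs) = emitClauses bits cs ⨾ emitClause bits c

clausesTime : ℕ → ℕ → ℕ
clausesTime e zero    = 1
clausesTime e (suc k) = clausesTime e k + (e + e)

clausesTime-mono : ∀ e {j k} → j ≤ k → clausesTime e j ≤ clausesTime e k
clausesTime-mono e {k = zero}  z≤n       = ℕ.≤-refl
clausesTime-mono e {k = suc k} z≤n       = ℕ.≤-trans (clausesTime-mono e {k = k} z≤n) (ℕ.m≤m+n _ _)
clausesTime-mono e             (s≤s j≤k) = ℕ.+-monoˡ-≤ (e + e) (clausesTime-mono e j≤k)

literalTime-mono : ∀ {j k} → j ≤ k → literalTime j ≤ literalTime k
literalTime-mono {j} {k} j≤k = s≤s (ℕ.+-mono-≤ (loopTime-mono {1} ℕ.≤-refl j≤k)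
  (ℕ.+-monoˡ-≤ 1 (loopTime-mono {1} {1} {suc j} {suc k} ℕ.≤-refl (s≤s j≤k))))

encodeFormula : 2-CNF → List Bool
encodeFormula = concatMap encodeClause

formulaTape : 2-CNF → Tape 4
formulaTape φ = outTape (encodeFormula φ)

symbol : Cell → Sym
symbol (just b) = bit b
symbol nothing  = ▪

module _ {I N : Tape 4} {M : ℕ} {pos : Fin 3 → ℕ} {before after : Fin 3 → List Sym} {bits : Fin 3 → Bool}
         (positions : ∀ i → Position (pos i) (before i)) (pos≤M : ∀ i → pos i ≤ M) where

  tapeOf : Fin 3 → Tape 4
  tapeOf i = tape (before i) (bit (bits i)) (after i)

  withOutput : List Bool → Tapes
  withOutput w = I ∷ outTape w ∷ N ∷ tapeOf 0F ∷ tapeOf 1F ∷ tapeOf 2F ∷ []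

  runs-slot : ∀ i s {w} → Runs (emitLiteral (suc i) (bits i) s) (literalTime M)
                               (withOutput w) (withOutput (encodeLiteral (literal s (pos i)) ++ w))
  runs-slot i s = slower (literalTime-mono (pos≤M i)) (at-slot i)
    where
    at-slot : ∀ i {w} → Runs (emitLiteral (suc i) (bits i) s) (literalTime (pos i))
                             (withOutput w) (withOutput (encodeLiteral (literal s (pos i)) ++ w))
    at-slot 0F = runs-emitLiteral 1F (bits 0F) s {R = N ∷ tapeOf 1F ∷ tapeOf 2F ∷ []} (positions 0F)
    at-slot 1F = runs-emitLiteral 2F (bits 1F) s {R = N ∷ tapeOf 0F ∷ tapeOf 2F ∷ []} (positions 1F)
    at-slot 2F = runs-emitLiteral 3F (bits 2F) s {R = N ∷ tapeOf 0F ∷ tapeOf 1F ∷ []} (positions 2F)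

  runs-clauses : ∀ cs {φ} → Runs (emitClauses bits cs) (clausesTime (literalTime M) (length cs))
    (withOutput (encodeFormula φ)) (withOutput (encodeFormula (map (globalise pos) cs ++ φ)))
  runs-clauses []                             = runs-idle
  runs-clauses (((s , i) , (t , j)) ∷ cs) {φ} = runs-clauses cs then
    subst (λ w → Runs (emitClause bits ((s , i) , (t , j))) (literalTime M + literalTime M)
                 (withOutput rest) (withOutput w))
      (sym (++-assoc (encodeLiteral (literal s (pos i))) _ rest))
      (runs-slot j t then runs-slot i s)
    where
    rest = encodeFormula (map (globalise pos) cs ++ φ)

module _ (i : Fin 3) (p : Bool → Program) {I O : Tape 4} {T : Vec (Tape 4) 4} where

  runs-switch-bit : ∀ x {us} → lookup (Vec.map head T) (suc i) ≡ bit x → ∀ {b} →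
                    Runs (p x) b (I ∷ O ∷ T) us → Runs (switch i p) (2 + b) (I ∷ O ∷ T) us
  runs-switch-bit true  eq r = runs-true (cong isBit eq) (runs-true (cong isOne eq) r)
  runs-switch-bit false eq r = runs-true (cong isBit eq) (runs-false (cong isOne eq) r)

  runs-switch-blank : lookup (Vec.map head T) (suc i) ≡ ▪ → ∀ {b} →
                      Runs (switch i p) (2 + b) (I ∷ O ∷ T) (I ∷ O ∷ T)
  runs-switch-blank eq = slower (ℕ.m≤m+n 2 _) (runs-false (cong isBit eq) runs-idle)

runs-loop-of : ∀ {p b j k ts us} → j ≡ k → Runs p (loopTime b j) ts us → Runs p (loopTime b k) ts us
runs-loop-of refl r = r

-- The enumeration of the triples

-- The vertices from number k to the last one, with k kept in the type: it is the row or column that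
-- a head has reached, and matching on the list turns it into `toℕ` of the current vertex.
data Interval {n : ℕ} : ℕ → List (Fin n) → Set where
  []  : Interval n []
  _∷_ : ∀ v {vs} → Interval (suc (toℕ v)) vs → Interval (toℕ v) (v ∷ vs)

interval-suc : ∀ {n k} {vs : List (Fin n)} → Interval k vs → Interval (suc k) (map suc vs)
interval-suc []       = []
interval-suc (v ∷ vs) = suc v ∷ interval-suc vs

allFin-suc : ∀ n → allFin (suc n) ≡ zero ∷ map suc (allFin n)
allFin-suc n = cong (zero ∷_) (sym (map-tabulate id suc))

allFin-interval : ∀ n → Interval 0 (allFin n)
allFin-interval zero    = []
allFin-interval (suc n) =
  subst (Interval 0) (sym (allFin-suc n)) (zero ∷ interval-suc (allFin-interval n))

length-allFin : ∀ n → length (allFin n) ≡ n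
length-allFin n = length-tabulate id

moves : Vec Move 4 → Program
moves ds = perform λ { (x ∷ y ∷ s) → keep x ∷ keep y ∷ Vec.zipWith _,_ s ds }

-- The first move leaves the right-hand `$`, on which the sweep would stop at once; the last two
-- step over the left-hand `$` and the separator after it.
rewind : Fin 4 → Program
rewind i = onTape i nothing (_, left) ⨾ sweep i left isEnd nothing ⨾
           onTape i nothing (_, right) ⨾ onTape i nothing (_, right)

rewindTime : ℕ → ℕ
rewindTime k = 1 + (loopTime 1 (suc k) + (1 + 1))

runs-rewind : ∀ {i} {R : Vec (Tape 4) 3} {I w k} xs → All Plain xs → length xs ≡ k →
  Runs (rewind i) (rewindTime k)
    (I ∷ outTape w ∷ insertAt R i (tape (xs ʳ++ (♯ ∷ [ $ ])) $ []))
    (I ∷ outTape w ∷ insertAt R i (at (♯ ∷ [ $ ]) (xs ++ [ $ ])))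
runs-rewind {i} {R} {I} {w} xs plain refl =
  runs-move {o = nothing} {t = tape (xs ʳ++ (♯ ∷ [ $ ])) $ []} (move-left (xs ʳ++ (♯ ∷ [ $ ])) []) then
  runs-sweep-back {i = i} {R} {isEnd} refl {nothing} (♯ ∷ xs) (refl ∷ All.map proj₁ plain) then
  runs-move {o = nothing} {t = tape [] $ (♯ ∷ xs ++ [ $ ])} refl then
  runs-move {o = nothing} {t = tape [ $ ] ♯ (xs ++ [ $ ])} (move-right [ $ ] (xs ++ [ $ ]))

-- Rows and positions on the matrix tapes

module Matrix {n} (G : Graph n) where

  row : Fin n → List (Fin n) → List Sym
  row u ws = map (λ w → symbol (cell G u w)) ws

  symbol-plain : ∀ x → Plain (symbol x)
  symbol-plain nothing  = refl , refl
  symbol-plain (just b) = refl , refl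

  symbol-inside : ∀ x → isSeparator (symbol x) ≡ false
  symbol-inside nothing  = refl
  symbol-inside (just b) = refl

  row-plain : ∀ u ws → All Plain (row u ws)
  row-plain u ws = All.map⁺ (All.universal (λ w → symbol-plain (cell G u w)) ws)

  row-inside : ∀ u ws → All (λ x → isSeparator x ≡ false) (row u ws)
  row-inside u ws = All.map⁺ (All.universal (λ w → symbol-inside (cell G u w)) ws)

  next-cell : ∀ {u v ls} → Position var⟨ u , v ⟩ ls →
              Position (suc (toℕ u * suc n + suc (toℕ v))) (symbol (cell G u v) ∷ ls)
  next-cell {u} {v} {ls} p = subst (λ k → Position k (symbol (cell G u v) ∷ ls))
    (cong suc (sym (ℕ.+-suc (toℕ u * suc n) (toℕ v))))
    (position-ʳ++ [ symbol (cell G u v) ] (symbol-plain (cell G u v) ∷ []) p)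

  allRow : Fin n → List Sym
  allRow u = row u (allFin n)

  rows : List (Fin n) → List Sym
  rows []       = []
  rows (u ∷ us) = allRow u ++ ♯ ∷ rows us

  length-allRow : ∀ u → length (allRow u) ≡ n
  length-allRow u = trans (length-map _ (allFin n)) (length-allFin n)

  -- A row adds its n cells and one separator. The summand 0 is the column, which lets the start of
  -- a row serve as the start of a loop over `allFin n`.
  next-row : ∀ {u : Fin n} {ls} → Position (suc (toℕ u * suc n + 0)) ls →
             Position (suc (suc (toℕ u) * suc n + 0)) (♯ ∷ (allRow u ʳ++ ls))
  next-row {u} {ls} p = subst (λ k → Position k (♯ ∷ (allRow u ʳ++ ls))) eq
    (position-ʳ++ [ ♯ ] ((refl , refl) ∷ []) (position-ʳ++ (allRow u) (row-plain u (allFin n)) p))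
    where
    eq : suc (length (allRow u) + suc (toℕ u * suc n + 0)) ≡ suc (suc n + toℕ u * suc n + 0)
    eq = cong suc (trans (ℕ.+-suc _ _) (cong suc
      (trans (cong (_+ (toℕ u * suc n + 0)) (length-allRow u)) (sym (ℕ.+-assoc n _ 0)))))

  rows-plain : ∀ us → All Plain (rows us)
  rows-plain []       = []
  rows-plain (u ∷ us) = All.++⁺ (row-plain u (allFin n)) ((refl , refl) ∷ rows-plain us)

  length-rows : ∀ us → length (rows us) ≡ length us * suc n
  length-rows []       = refl
  length-rows (u ∷ us) = trans (length-++ (allRow u)) (trans (ℕ.+-suc _ _)
    (cong suc (cong₂ _+_ (length-allRow u) (length-rows us))))

  allRows : List Sym
  allRows = rows (allFin n)

  length-allRows : length allRows ≡ n * suc n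
  length-allRows = trans (length-rows (allFin n)) (cong (_* suc n) (length-allFin n))

  firstRow : Tape 4
  firstRow = at (♯ ∷ [ $ ]) (allRows ++ [ $ ])

module BuildTime (n : ℕ) where

  scanTime buildRowTime prepareTime finishTime : ℕ
  scanTime     = loopTime 1 n + (1 + (loopTime 1 n + 1))
  buildRowTime = 1 + (loopTime 1 n + (1 + scanTime))
  prepareTime  = 1 + (1 + (loopTime 1 n + 1))
  finishTime   = 1 + (rewindTime (n * suc n) + (rewindTime (n * suc n) + rewindTime (n * suc n)))

module Time (size n : ℕ) where

  open BuildTime n

  maxVar visitTime time₃ time₂ time₁ totalTime : ℕ
  maxVar    = suc (n * suc n + n)
  visitTime = 2 + (2 + (2 + clausesTime (literalTime maxVar) size))
  time₃     = loopTime (visitTime + 1) n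
  time₂     = loopTime (time₃ + (1 + (1 + (loopTime 1 n + 1)))) n
  time₁     = loopTime (time₂ + (1 + (loopTime 1 n + (1 + rewindTime (n * suc n))))) n
  totalTime = prepareTime + (loopTime buildRowTime n + (finishTime + (time₁ + 1)))

module Loops (K : Bool → Bool → Bool → List LocalClause) {size : ℕ}
             (K-bounded : ∀ a b c → length (K a b c) ≤ size) where

  visit₃ : Bool → Bool → Bool → Program
  visit₃ a b c = emitClauses (triple a b c) (K a b c)

  visit₂ : Bool → Bool → Program
  visit₂ a b = switch 2F (visit₃ a b)

  visit₁ : Bool → Program
  visit₁ a = switch 1F (visit₂ a)

  visit : Program
  visit = switch 0F visit₁

  -- Tape 1F stands at column v and tape 2F at column w of row u, tape 3F at column w of row v. For
  -- the next v, 1F advances by a cell, 3F goes on into the next row and 2F returns to the start of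
  -- row u. For the next u, 1F and 2F go on into the next row and 3F is rewound. No head ever
  -- searches for a vertex.
  loop₃ loop₂ loop₁ : Program
  loop₃ = while (until 2F isSeparator) (visit ⨾ moves (stay ∷ stay ∷ right ∷ right ∷ []))
  loop₂ = while (until 1F isSeparator)
    (loop₃ ⨾ moves (stay ∷ right ∷ stay ∷ right ∷ []) ⨾
     onTape 2F nothing (_, left) ⨾ sweep 2F left isSeparator nothing ⨾ onTape 2F nothing (_, right))
  loop₁ = while (until 1F isEnd)
    (loop₂ ⨾ moves (stay ∷ right ∷ stay ∷ stay ∷ []) ⨾
     sweep 2F right isSeparator nothing ⨾ onTape 2F nothing (_, right) ⨾ rewind 3F)

  module _ {n} (G : Graph n) {I N : Tape 4} where

    open Reduce K G
    open Matrix G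

    open Time size n

    var≤max : ∀ u v → var⟨ u , v ⟩ ≤ maxVar
    var≤max u v = s≤s (ℕ.+-mono-≤ (ℕ.*-monoˡ-≤ (suc n) (ℕ.<⇒≤ (Fin.toℕ<n u))) (ℕ.<⇒≤ (Fin.toℕ<n v)))

    runs-visit : ∀ {u v w la lb lc ra rb rc φ} →
      Position var⟨ u , v ⟩ la → Position var⟨ u , w ⟩ lb → Position var⟨ v , w ⟩ lc → ∀ x y z →
      let T = N ∷ tape la (symbol x) ra ∷ tape lb (symbol y) rb ∷ tape lc (symbol z) rc ∷ [] in
      Runs visit visitTime (I ∷ formulaTape φ ∷ T)
        (I ∷ formulaTape (extend K x y z var⟨ u , v ⟩ var⟨ u , w ⟩ var⟨ v , w ⟩ φ) ∷ T)
    runs-visit _ _ _ nothing  _        _        = runs-switch-blank 0F visit₁ refl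
    runs-visit _ _ _ (just a) nothing  _        =
      runs-switch-bit 0F visit₁ a refl (runs-switch-blank 1F (visit₂ a) refl)
    runs-visit _ _ _ (just a) (just b) nothing  =
      runs-switch-bit 0F visit₁ a refl (runs-switch-bit 1F (visit₂ a) b refl
        (runs-switch-blank 2F (visit₃ a b) refl))
    runs-visit {u} {v} {w} {la} {lb} {lc} {ra} {rb} {rc} p q r (just a) (just b) (just c) =
      runs-switch-bit 0F visit₁ a refl (runs-switch-bit 1F (visit₂ a) b refl
        (runs-switch-bit 2F (visit₃ a b) c refl
          (slower (clausesTime-mono _ (K-bounded a b c))
            (runs-clauses {before = triple la lb lc} {triple ra rb rc} {triple a b c}
              positions bounds (K a b c)))))
      where
      positions : ∀ i → Position (triple var⟨ u , v ⟩ var⟨ u , w ⟩ var⟨ v , w ⟩ i) (triple la lb lc i)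
      positions 0F = p
      positions 1F = q
      positions 2F = r
      bounds : ∀ i → triple var⟨ u , v ⟩ var⟨ u , w ⟩ var⟨ v , w ⟩ i ≤ maxVar
      bounds 0F = var≤max u v
      bounds 1F = var≤max u w
      bounds 2F = var≤max v w

    -- Matching on the interval turns k into `toℕ w`, so that the last two positions become the
    -- variables of uw and vw.
    runs-loop₃ : ∀ {u v k ws φ la ra lb rb lc rc} → Interval k ws → Position var⟨ u , v ⟩ la →
      Position (suc (toℕ u * suc n + k)) lb → Position (suc (toℕ v * suc n + k)) lc →
      let A = tape la (symbol (cell G u v)) ra in
      Runs loop₃ (loopTime (visitTime + 1) (length ws))
        (I ∷ formulaTape φ ∷ N ∷ A ∷ at lb (row u ws ++ ♯ ∷ rb) ∷ at lc (row v ws ++ ♯ ∷ rc) ∷ [])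
        (I ∷ formulaTape (foldl (addTriple u v) φ ws) ∷ N ∷ A ∷
          tape (row u ws ʳ++ lb) ♯ rb ∷ tape (row v ws ʳ++ lc) ♯ rc ∷ [])
    runs-loop₃ [] p q r = runs-stop refl
    runs-loop₃ {u} {v} {_} {w ∷ ws} {φ} {la} {ra} {lb} {rb} {lc} {rc} (.w ∷ i) p q r =
      runs-again (cong not (symbol-inside (cell G u w)))
        (runs-visit {u} {v} {w} p q r (cell G u v) (cell G u w) (cell G v w) then
         runs-perform (cong₂ (λ B C → I ∷ formulaTape (addTriple u v φ w) ∷ N ∷ A ∷ B ∷ C ∷ [])
           (move-right lb {symbol (cell G u w)} (row u ws ++ ♯ ∷ rb))
           (move-right lc {symbol (cell G v w)} (row v ws ++ ♯ ∷ rc))))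
        (runs-loop₃ i p (next-cell q) (next-cell r))
      where A = tape la (symbol (cell G u v)) ra

    -- The same k is the column of tape 1F and the row of tape 3F, as both follow v. The left part
    -- of tape 2F begins with a separator, at which its return sweep stops.
    runs-loop₂ : ∀ {u k vs φ la ra lb rb lc} → Interval k vs →
      Position (suc (toℕ u * suc n + k)) la → Position (suc (toℕ u * suc n + 0)) (♯ ∷ lb) →
      Position (suc (k * suc n + 0)) lc →
      let B = at (♯ ∷ lb) (allRow u ++ ♯ ∷ rb) in
      Runs loop₂ (loopTime (time₃ + (1 + (1 + (loopTime 1 n + 1)))) (length vs))
        (I ∷ formulaTape φ ∷ N ∷ at la (row u vs ++ ♯ ∷ ra) ∷ B ∷ at lc (rows vs ++ [ $ ]) ∷ [])
        (I ∷ formulaTape (foldl (addPair u) φ vs) ∷ N ∷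
          tape (row u vs ʳ++ la) ♯ ra ∷ B ∷ tape (rows vs ʳ++ lc) $ [] ∷ [])
    runs-loop₂ [] p q r = runs-stop refl
    runs-loop₂ {u} {_} {v ∷ vs} {φ} {la} {ra} {lb} {rb} {lc} (.v ∷ i) p q r
      rewrite ++-assoc (allRow v) (♯ ∷ rows vs) [ $ ] | ++-ʳ++ (allRow v) {♯ ∷ rows vs} {lc} =
      runs-again (cong not (symbol-inside (cell G u v)))
        (runs-loop-of (length-allFin n)
           (runs-loop₃ (allFin-interval n) p q r) then
         runs-perform (cong₂ (λ A C → I ∷ formulaTape φ′ ∷ N ∷ A ∷ B′ ∷ C ∷ [])
           (move-right la {symbol (cell G u v)} (row u vs ++ ♯ ∷ ra))
           (move-right (allRow v ʳ++ lc) {♯} (rows vs ++ [ $ ]))) then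
         runs-move {i = 2F} {R} {nothing} {left} {encodeFormula φ′} {B′}
           (move-left (allRow u ʳ++ (♯ ∷ lb)) {♯} rb) then
         runs-loop-of (length-allRow u)
           (runs-sweep-back {i = 2F} {R} {isSeparator} {♯} refl {nothing} {encodeFormula φ′}
             (allRow u) (row-inside u (allFin n))) then
         runs-move {i = 2F} {R} {nothing} {right} {encodeFormula φ′} {tape lb ♯ (allRow u ++ ♯ ∷ rb)}
           (move-right lb {♯} (allRow u ++ ♯ ∷ rb)))
        (runs-loop₂ i (next-cell p) q (next-row r))
      where
      φ′ = addPair u φ v
      B′ = tape (allRow u ʳ++ (♯ ∷ lb)) ♯ rb
      R  = N ∷ at (symbol (cell G u v) ∷ la) (row u vs ++ ♯ ∷ ra) ∷
           at (♯ ∷ (allRow v ʳ++ lc)) (rows vs ++ [ $ ]) ∷ []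

    -- Between passes the first two matrix tapes agree, both at the start of row u, and the third is
    -- back at its first row; hence one position hypothesis serves for both.
    runs-loop₁ : ∀ {k us φ la} → Interval k us → Position (suc (k * suc n + 0)) (♯ ∷ la) →
      let A  = at (♯ ∷ la) (rows us ++ [ $ ])
          A′ = tape (rows us ʳ++ (♯ ∷ la)) $ [] in
      Runs loop₁ (loopTime (time₂ + (1 + (loopTime 1 n + (1 + rewindTime (n * suc n))))) (length us))
        (I ∷ formulaTape φ ∷ N ∷ A ∷ A ∷ firstRow ∷ [])
        (I ∷ formulaTape (foldl addVertex φ us) ∷ N ∷ A′ ∷ A′ ∷ firstRow ∷ [])
    runs-loop₁ [] p = runs-stop refl
    runs-loop₁ {_} {u ∷ us} {φ} {la} (.u ∷ i) p
      rewrite ++-assoc (allRow u) (♯ ∷ rows us) [ $ ] | ++-ʳ++ (allRow u) {♯ ∷ rows us} {♯ ∷ la} =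
      runs-again (cong not (not-end (allRow u) (row-plain u (allFin n))))
        (runs-loop-of (length-allFin n)
           (runs-loop₂ {u} {lb = la} {rb = rest} {♯ ∷ [ $ ]} (allFin-interval n) p p position-first) then
         runs-perform (cong (λ A → I ∷ formulaTape φ′ ∷ N ∷ A ∷ B ∷ C ∷ []) (move-right ls {♯} rest)) then
         runs-loop-of (length-allRow u)
           (runs-sweep-right {i = 2F} {N ∷ A′ ∷ C ∷ []} {isSeparator} refl {encodeFormula φ′}
             (allRow u) (row-inside u (allFin n))) then
         runs-move {i = 2F} {N ∷ A′ ∷ C ∷ []} {nothing} {right} {encodeFormula φ′} {tape ls ♯ rest}
           (move-right ls rest) then
         runs-rewind {3F} {N ∷ A′ ∷ A′ ∷ []} allRows (rows-plain (allFin n)) length-allRows)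
        (runs-loop₁ i (next-row p))
      where
      rest = rows us ++ [ $ ]
      φ′   = addVertex φ u
      ls   = allRow u ʳ++ (♯ ∷ la)
      A′   = at (♯ ∷ ls) rest
      B    = at (♯ ∷ la) (allRow u ++ ♯ ∷ rest)
      C    = tape (allRows ʳ++ (♯ ∷ [ $ ])) $ []

      not-end : ∀ xs {ls rs} → All Plain xs → isEnd (head (at ls (xs ++ ♯ ∷ rs))) ≡ false
      not-end []       _       = refl
      not-end (x ∷ xs) (p ∷ _) = proj₁ p


-- The construction of the matrix

copy : (Sym → Sym) → (Sym → Sym) → Program
copy f g = perform λ where
  (x ∷ y ∷ z ∷ _) → (x , right) ∷ keep y ∷ (g z , right) ∷
                    (f x , right) ∷ (f x , right) ∷ (f x , right) ∷ []

onMatrix : Sym → Move → Program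
onMatrix a d = perform λ where
  (x ∷ y ∷ z ∷ _) → keep x ∷ keep y ∷ keep z ∷ (a , d) ∷ (a , d) ∷ (a , d) ∷ []

-- The counter takes the place of comparing w with u: below its marks ✗ the cells are blotted, the
-- diagonal cell is blotted while u itself is crossed out, which readies the counter for the next
-- row, and the rest is copied.
scanRow buildRow buildRows : Program
scanRow =
  while (λ hs → isMark (lookup hs 2F)) (copy (λ _ → ▪) (λ _ → ✗)) ⨾
  copy (λ _ → ▪) (λ _ → ✗) ⨾
  while (λ hs → isOne (lookup hs 2F)) (copy id id) ⨾
  onMatrix ♯ right
buildRow =
  onTape 0F nothing (_, left) ⨾ sweep 0F left isEnd nothing ⨾ onTape 0F nothing (_, right) ⨾ scanRow
buildRows = while (λ hs → isBit (lookup hs 0F)) buildRow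

building : Tape 4 → Tape 4 → List Sym → Tapes
building I N la = I ∷ outTape [] ∷ N ∷ tape la blank [] ∷ tape la blank [] ∷ tape la blank [] ∷ []

runs-copy : ∀ {f g li x xs ln z zs la c z′} → g z ≡ z′ → f x ≡ c →
  Runs (copy f g) 1 (building (tape li x xs) (tape ln z zs) la)
                    (building (at (x ∷ li) xs) (at (z′ ∷ ln) zs) (c ∷ la))
runs-copy {f} {g} {li} {x} {xs} {ln} {z} {zs} {la} refl refl =
  runs-perform (cong₂ (λ I N → building I N (f x ∷ la)) (move-right li xs) (move-right ln zs))

module _ {A : Set} (P : Sym → Bool) {f g : Sym → Sym} {x z z′ c : A → Sym} {s : Sym}
         (stop : P s ≡ false) where

  runs-copies : ∀ {ws} → All (λ w → P (z w) ≡ true × g (z w) ≡ z′ w × f (x w) ≡ c w) ws →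
    ∀ {li ri ln rn la} →
    Runs (while (λ hs → P (lookup hs 2F)) (copy f g)) (loopTime 1 (length ws))
      (building (at li (map x ws ++ ri)) (at ln (map z ws ++ s ∷ rn)) la)
      (building (at (map x ws ʳ++ li) ri) (tape (map z′ ws ʳ++ ln) s rn) (map c ws ʳ++ la))
  runs-copies [] = runs-stop stop
  runs-copies {w ∷ ws} ((go , written , copied) ∷ ps) {li} {ri} {ln} {rn} {la} =
    runs-again go
      (runs-copy {f} {g} {li} {x w} {map x ws ++ ri} {ln} {z w} {map z ws ++ s ∷ rn} {la} written copied)
      (runs-copies ps)

-- On the counter tape the vertices that precede the current row are crossed out.

counter : ∀ {n} → ℕ → Fin n → Sym
counter k w = if toℕ w <ᵇ k then ✗ else 𝟙

-- The parts of a row that the two loops of `scanRow` pass over, with the diagonal cell between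
-- them.
record Split {n} (u : Fin n) : Set where
  constructor split
  field
    {below above} : List (Fin n)
    is            : allFin n ≡ below ++ u ∷ above
    smaller       : All (Fin._< u) below
    larger        : All (u Fin.<_) above

split-allFin : ∀ {n} (u : Fin n) → Split u
split-allFin {suc n} zero    = split {below = []} refl [] (All.tabulate⁺ λ _ → z<s)
split-allFin {suc n} (suc u) with split-allFin u
... | split {below} {above} is smaller larger = split {below = zero ∷ map suc below}
  (trans (allFin-suc n) (cong (zero ∷_) (trans (cong (map suc) is) (map-++ suc below (u ∷ above)))))
  (z<s ∷ All.map⁺ (All.map s<s smaller)) (All.map⁺ (All.map s<s larger))

module _ {n} (G : Graph n) where

  open Matrix G
  open BuildTime n

  input : Fin n → List (Fin n) → List Sym
  input u ws = map (λ w → bit (adjacent G u w)) ws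

  inputRow : Fin n → List Sym
  inputRow u = input u (allFin n)

  counterTape : ℕ → Tape 4
  counterTape k = tape (map (counter k) (allFin n) ʳ++ [ $ ]) $ []

  length-parts : ∀ {u : Fin n} (s : Split u) → length (Split.below s) ≤ n × length (Split.above s) ≤ n
  length-parts (split {below} {above} is _ _) =
    ℕ.≤-trans (ℕ.m≤m+n _ _) (ℕ.≤-reflexive total) ,
    ℕ.≤-trans (ℕ.n≤1+n _) (ℕ.≤-trans (ℕ.m≤n+m _ (length below)) (ℕ.≤-reflexive total))
    where
    total : length below + suc (length above) ≡ n
    total = trans (sym (length-++ below)) (trans (cong length (sym is)) (length-allFin n))

  counter-<  : ∀ {k} {w : Fin n} → toℕ w < k → counter k w ≡ ✗
  counter-< w<k rewrite <⇒<ᵇ≡true w<k = refl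

  counter-≥ : ∀ {k} {w : Fin n} → k ≤ toℕ w → counter k w ≡ 𝟙
  counter-≥ k≤w rewrite ≮⇒<ᵇ≡false (ℕ.≤⇒≯ k≤w) = refl

  counter-plain : ∀ k ws → All (λ x → isEnd x ≡ false) (map (counter {n} k) ws)
  counter-plain k ws = All.map⁺ (All.universal not-end ws)
    where
    not-end : ∀ w → isEnd (counter k w) ≡ false
    not-end w with toℕ w <ᵇ k
    ... | true  = refl
    ... | false = refl

  runs-scanRow : ∀ {u} (s : Split u) {li ri la} → let ws = Split.below s ++ u ∷ Split.above s in
    Runs scanRow scanTime
      (building (at li (input u ws ++ ri)) (at [ $ ] (map (counter (toℕ u)) ws ++ [ $ ])) la)
      (building (at (input u ws ʳ++ li) ri) (tape (map (counter (suc (toℕ u))) ws ʳ++ [ $ ]) $ [])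
                (♯ ∷ (row u ws ʳ++ la)))
  runs-scanRow {u} s@(split {below} {above} _ smaller larger) {li} {ri} {la} =
    subst₂ (Runs scanRow scanTime)
      (cong₂ (λ i c → building (at li i) (at [ $ ] c) la)
        (sym (forward bits)) (sym (forward (counter (toℕ u)))))
      (trans (cong₂ (λ i c → building (at i ri) (tape c $ [])
                  (♯ ∷ (row u above ʳ++ (symbol (cell G u u) ∷ (row u below ʳ++ la)))))
                (sym (backward bits)) (sym (backward (counter (suc (toℕ u))))))
             (cong (λ r → building _ _ (♯ ∷ r)) (sym (backward (symbol ∘ cell G u)))))
      (slower (loopTime-mono ℕ.≤-refl (proj₁ (length-parts s)))
         (runs-copies isMark (cong isMark (counter-≥ {toℕ u} {u} ℕ.≤-refl))
           (All.map (λ {w} w<u → cong isMark (counter-< {toℕ u} {w} w<u) ,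
                          sym (counter-< {suc (toℕ u)} {w} (ℕ.m<n⇒m<1+n w<u)) ,
                          sym (cong symbol (cell-below G (ℕ.<-asym w<u)))) smaller)) then
       runs-copy (sym (counter-< {suc (toℕ u)} {u} ℕ.≤-refl))
         (sym (cong symbol (cell-below G {u} {u} (ℕ.<-irrefl refl)))) then
       slower (loopTime-mono ℕ.≤-refl (proj₂ (length-parts s)))
         (runs-copies isOne refl
           (All.map (λ {w} u<w → cong isOne (counter-≥ {toℕ u} {w} (ℕ.<⇒≤ u<w)) ,
                          trans (counter-≥ {toℕ u} {w} (ℕ.<⇒≤ u<w))
                                (sym (counter-≥ {suc (toℕ u)} {w} u<w)) ,
                          sym (cong symbol (cell-above G u<w))) larger)) then
       runs-perform refl)
    where
    bits : Fin n → Sym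
    bits w = bit (adjacent G u w)

    forward : ∀ (f : Fin n → Sym) {r} →
              map f (below ++ u ∷ above) ++ r ≡ map f below ++ f u ∷ (map f above ++ r)
    forward f {r} = trans (cong (_++ r) (map-++ f below (u ∷ above))) (++-assoc (map f below) _ r)

    backward : ∀ (f : Fin n → Sym) {l} →
               map f (below ++ u ∷ above) ʳ++ l ≡ map f above ʳ++ (f u ∷ (map f below ʳ++ l))
    backward f {l} = trans (cong (_ʳ++ l) (map-++ f below (u ∷ above))) (++-ʳ++ (map f below))

  runs-buildRow : ∀ {u li ri la} →
    Runs buildRow buildRowTime
      (building (at li (inputRow u ++ ri)) (counterTape (toℕ u)) la)
      (building (at (inputRow u ʳ++ li) ri) (counterTape (suc (toℕ u))) (♯ ∷ (allRow u ʳ++ la)))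
  runs-buildRow {u} {li} {ri} {la} =
    runs-move {i = 0F} {R} {nothing} {left} {[]} {counterTape (toℕ u)}
      (move-left (marks ʳ++ [ $ ]) []) then
    runs-loop-of (trans (length-map _ (allFin n)) (length-allFin n))
      (runs-sweep-back {i = 0F} {R} {isEnd} {$} refl {nothing} {[]}
        marks (counter-plain (toℕ u) (allFin n))) then
    runs-move {i = 0F} {R} {nothing} {right} {[]} {tape [] $ (marks ++ [ $ ])}
      (move-right [] (marks ++ [ $ ])) then
    subst (λ vs → Runs scanRow scanTime
        (building (at li (input u vs ++ ri)) (at [ $ ] (map (counter (toℕ u)) vs ++ [ $ ])) la)
        (building (at (input u vs ʳ++ li) ri) (tape (map (counter (suc (toℕ u))) vs ʳ++ [ $ ]) $ [])
                  (♯ ∷ (row u vs ʳ++ la))))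
      (sym (Split.is s)) (runs-scanRow s)
    where
    s = split-allFin u
    marks = map (counter (toℕ u)) (allFin n)
    R = tape la blank [] ∷ tape la blank [] ∷ tape la blank [] ∷ []

  inputRows : List (Fin n) → List Sym
  inputRows []       = []
  inputRows (u ∷ us) = inputRow u ++ inputRows us

  -- A vertex u rules out an empty row; n is generalised here so that it can be matched.
  input-bit : ∀ {n} (G : Graph n) u {li ri} →
              isBit (head (at li (map (λ w → bit (adjacent G u w)) (allFin n) ++ ri))) ≡ true
  input-bit {suc n} G u = refl

  runs-buildRows : ∀ {k us} → Interval k us → ∀ {li la} →
    Runs buildRows (loopTime buildRowTime (length us))
      (building (at li (inputRows us)) (counterTape k) la)
      (building (at (inputRows us ʳ++ li) []) (counterTape n) (rows us ʳ++ la))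
  runs-buildRows [] = runs-stop refl
  runs-buildRows {us = u ∷ us} (.u ∷ i) {li} {la} =
    runs-again (input-bit G u) (runs-buildRow {u})
      (subst₂ (λ x y → Runs buildRows (loopTime buildRowTime (length us))
          (building (at (inputRow u ʳ++ li) (inputRows us)) (counterTape (suc (toℕ u)))
                    (♯ ∷ (allRow u ʳ++ la)))
          (building (at x []) (counterTape n) y))
        (sym (++-ʳ++ (inputRow u))) (sym (++-ʳ++ (allRow u)))
        (runs-buildRows i))

-- Preparing the tapes and closing the matrix

countVertices prepare finish : Program
countVertices = while (λ hs → isOne (lookup hs 0F))
  (perform λ where (x ∷ y ∷ z ∷ s) → (x , right) ∷ keep y ∷ (𝟙 , right) ∷ Vec.map keep s)
prepare =
  perform (λ where
    (x ∷ y ∷ _) → keep x ∷ keep y ∷ ($ , right) ∷ ($ , right) ∷ ($ , right) ∷ ($ , right) ∷ []) ⨾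
  onMatrix ♯ right ⨾
  countVertices ⨾
  perform (λ where (x ∷ y ∷ z ∷ s) → (x , right) ∷ keep y ∷ ($ , stay) ∷ Vec.map keep s)
finish = onMatrix $ stay ⨾ rewind 1F ⨾ rewind 2F ⨾ rewind 3F

runs-prepare : ∀ n {is} →
  Runs prepare (BuildTime.prepareTime n)
    (at [] (replicate n 𝟙 ++ bit false ∷ is) ∷ blankTape ∷ Vec.replicate 4 blankTape)
    (building (at (bit false ∷ (replicate n 𝟙 ʳ++ [])) is)
              (tape (replicate n 𝟙 ʳ++ [ $ ]) $ []) (♯ ∷ [ $ ]))
runs-prepare n {is} =
  runs-perform refl then
  runs-perform refl then
  count n then
  runs-perform (cong (λ I → building I (tape (replicate n 𝟙 ʳ++ [ $ ]) $ []) (♯ ∷ [ $ ]))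
    (move-right (replicate n 𝟙 ʳ++ []) is))
  where
  count : ∀ k {li ln} → Runs countVertices (loopTime 1 k)
    (building (at li (replicate k 𝟙 ++ bit false ∷ is)) (tape ln blank []) (♯ ∷ [ $ ]))
    (building (tape (replicate k 𝟙 ʳ++ li) (bit false) is)
              (tape (replicate k 𝟙 ʳ++ ln) blank []) (♯ ∷ [ $ ]))
  count zero = runs-stop refl
  count (suc k) {li} {ln} = runs-again refl
    (runs-perform (cong (λ I → building I (tape (𝟙 ∷ ln) blank []) (♯ ∷ [ $ ]))
      (move-right li {𝟙} (replicate k 𝟙 ++ bit false ∷ is))))
    (count k)

module _ {n} (G : Graph n) {I N : Tape 4} where

  open Matrix G
  open BuildTime n using (finishTime)

  runs-finish : Runs finish finishTime (building I N (allRows ʳ++ (♯ ∷ [ $ ])))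
                  (I ∷ outTape [] ∷ N ∷ firstRow ∷ firstRow ∷ firstRow ∷ [])
  runs-finish =
    runs-perform refl then
    runs-rewind {1F} {N ∷ end ∷ end ∷ []} allRows (rows-plain (allFin n)) length-allRows then
    runs-rewind {2F} {N ∷ firstRow ∷ end ∷ []} allRows (rows-plain (allFin n)) length-allRows then
    runs-rewind {3F} {N ∷ firstRow ∷ firstRow ∷ []} allRows (rows-plain (allFin n)) length-allRows
    where
    end = tape (allRows ʳ++ (♯ ∷ [ $ ])) $ []


-- Polynomial time

-- A bare power suffices: as the base is at least 2, a constant c is below the c-th power, and a sum
-- of two powers is absorbed by a larger exponent. No coefficients have to be carried along.
Polynomial : (ℕ → ℕ) → Set
Polynomial b = ∃[ d ] ∀ n → b n ≤ (2 + n) ^ d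

^-mono : ∀ n {d e} → d ≤ e → (2 + n) ^ d ≤ (2 + n) ^ e
^-mono n = ℕ.^-monoʳ-≤ (2 + n)

poly-const : ∀ c → Polynomial λ _ → c
poly-const c = c , below c
  where
  below : ∀ c n → c ≤ (2 + n) ^ c
  below zero    n = z≤n
  below (suc c) n = ℕ.+-mono-≤ (ℕ.m^n>0 (2 + n) c)
    (ℕ.≤-trans (below c n) (ℕ.m≤m+n _ (n * (2 + n) ^ c)))

poly-id : Polynomial id
poly-id = 1 , λ n → ℕ.≤-trans (ℕ.m≤n+m n 2) (ℕ.≤-reflexive (sym (ℕ.^-identityʳ (2 + n))))

module _ {b c : ℕ → ℕ} where

  poly-+ : Polynomial b → Polynomial c → Polynomial λ n → b n + c n
  poly-+ (d , b≤) (e , c≤) = suc (d + e) , λ n → ℕ.+-mono-≤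
    (ℕ.≤-trans (b≤ n) (^-mono n (ℕ.m≤m+n d e)))
    (ℕ.≤-trans (c≤ n) (ℕ.≤-trans (^-mono n (ℕ.m≤n+m e d)) (ℕ.m≤m+n _ _)))

  poly-* : Polynomial b → Polynomial c → Polynomial λ n → b n * c n
  poly-* (d , b≤) (e , c≤) = d + e , λ n →
    ℕ.≤-trans (ℕ.*-mono-≤ (b≤ n) (c≤ n)) (ℕ.≤-reflexive (sym (ℕ.^-distribˡ-+-* (2 + n) d e)))

poly-≤ : ∀ {b c} → (∀ n → b n ≤ c n) → Polynomial c → Polynomial b
poly-≤ b≤c (d , c≤) = d , λ n → ℕ.≤-trans (b≤c n) (c≤ n)

poly-suc : ∀ {b} → Polynomial b → Polynomial (suc ∘ b)
poly-suc = poly-+ (poly-const 1)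

poly-loop : ∀ {b k} → Polynomial b → Polynomial k → Polynomial λ n → loopTime (b n) (k n)
poly-loop {b} {k} pb pk = poly-≤ (λ n → ℕ.≤-reflexive (closed (b n) (k n)))
  (poly-+ (poly-* pk (poly-suc pb)) (poly-const 1))
  where
  closed : ∀ b k → loopTime b k ≡ k * suc b + 1
  closed b zero    = refl
  closed b (suc k) = cong suc (trans (cong (b +_) (closed b k)) (sym (ℕ.+-assoc b (k * suc b) 1)))

poly-clauses : ∀ {e} → Polynomial e → ∀ k → Polynomial λ n → clausesTime (e n) k
poly-clauses pe zero    = poly-const 1
poly-clauses pe (suc k) = poly-+ (poly-clauses pe k) (poly-+ pe pe)

abstract

  -- Abstract, so that the degree stays an opaque number wherever it is mentioned.
  poly-total : ∀ size → Polynomial (Time.totalTime size)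
  poly-total size =
    poly-+ (poly-suc (poly-suc (poly-+ sweep-row one)))
      (poly-+ (poly-loop (poly-suc (poly-+ sweep-row (poly-suc scan))) poly-id)
        (poly-+ (poly-suc (poly-+ rewinding (poly-+ rewinding rewinding))) (poly-+ poly-time₁ one)))
    where
    open Time size
    one : Polynomial λ _ → 1
    one = poly-const 1

    sweep-row : Polynomial λ n → loopTime 1 n
    sweep-row = poly-loop one poly-id

    scan : Polynomial BuildTime.scanTime
    scan = poly-+ sweep-row (poly-suc (poly-+ sweep-row one))

    rewinding : Polynomial λ n → rewindTime (n * suc n)
    rewinding =
      poly-suc (poly-+ (poly-loop one (poly-suc (poly-* poly-id (poly-suc poly-id)))) (poly-const 2))

    poly-max : Polynomial maxVar
    poly-max = poly-suc (poly-+ (poly-* poly-id (poly-suc poly-id)) poly-id)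

    poly-visit : Polynomial visitTime
    poly-visit = poly-+ (poly-const 6) (poly-clauses
      (poly-suc (poly-+ (poly-loop one poly-max) (poly-+ (poly-loop one (poly-suc poly-max)) one))) size)

    poly-time₁ : Polynomial time₁
    poly-time₁ = poly-loop (poly-+ (poly-loop (poly-+ (poly-loop (poly-+ poly-visit one) poly-id)
        (poly-suc (poly-suc (poly-+ sweep-row one)))) poly-id)
      (poly-suc (poly-+ sweep-row (poly-suc rewinding)))) poly-id

*-^ : ∀ m n d → (m * n) ^ d ≡ m ^ d * n ^ d
*-^ m n zero    = refl
*-^ m n (suc d) = trans (cong ((m * n) *_) (*-^ m n d)) (ℕ.[m*n]*[o*p]≡[m*o]*[n*p] m n (m ^ d) (n ^ d))

-- The complete machine and its running time

module _ (K : Bool → Bool → Bool → List LocalClause) {size : ℕ}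
         (K-bounded : ∀ a b c → length (K a b c) ≤ size) where

  open Loops K K-bounded using (loop₁; runs-loop₁)

  reduction : Program
  reduction = prepare ⨾ buildRows ⨾ finish ⨾ loop₁ ⨾
    perform (λ where (x ∷ y ∷ s) → keep x ∷ (y , right) ∷ Vec.map keep s)

  open Compile reduction

  module _ {n} (G : Graph n) where

    open Matrix G using (rows; firstRow)

    encoded : map bit (encodeGraph (n , G)) ≡ replicate n 𝟙 ++ bit false ∷ inputRows G (allFin n)
    encoded = trans (map-++ bit (unary n) _) (trans (cong₂ _++_ (bits-unary n) (bits-rows (allFin n)))
                (++-assoc (replicate n 𝟙) _ _))
      where
      bits-unary : ∀ n → map bit (unary n) ≡ replicate n 𝟙 ++ [ bit false ]
      bits-unary n = trans (map-++ bit (replicate n true) _)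
        (cong (_++ [ bit false ]) (map-replicate bit n true))

      bits-rows : ∀ us → map bit (concatMap (λ u → map (adjacent G u) (allFin n)) us) ≡ inputRows G us
      bits-rows []       = refl
      bits-rows (u ∷ us) = trans (map-++ bit (map (adjacent G u) (allFin n)) _)
        (cong₂ _++_ (sym (map-∘ (allFin n))) (bits-rows us))

    counter-initial : tape (replicate n 𝟙 ʳ++ [ $ ]) $ [] ≡ counterTape G 0
    counter-initial = cong (λ xs → tape (xs ʳ++ [ $ ]) $ [])
      (trans (cong (λ k → replicate k 𝟙) (sym (length-allFin n))) (ones (allFin n)))
      where
      ones : ∀ (ws : List (Fin n)) → replicate (length ws) 𝟙 ≡ map (counter 0) ws
      ones []       = refl
      ones (w ∷ ws) = cong (𝟙 ∷_) (ones ws)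

    open Reduce K G using (formula)

    runs-reduction : ∃[ I ] ∃[ T ] Runs reduction (Time.totalTime size n)
      (at [] (replicate n 𝟙 ++ bit false ∷ inputRows G (allFin n)) ∷ Vec.replicate 5 blankTape)
      (I ∷ move right (formulaTape formula) ∷ T)
    runs-reduction = _ , _ ,
      (subst (λ N → Runs prepare (BuildTime.prepareTime n)
                (at [] (replicate n 𝟙 ++ bit false ∷ inputRows G (allFin n)) ∷ Vec.replicate 5 blankTape)
                (building (at (bit false ∷ (replicate n 𝟙 ʳ++ [])) (inputRows G (allFin n)))
                          N (♯ ∷ [ $ ])))
         counter-initial (runs-prepare n) then
       runs-loop-of (length-allFin n) (runs-buildRows G (allFin-interval n)) then
       runs-finish G then
       runs-loop-of (length-allFin n) (runs-loop₁ G (allFin-interval n) position-first) then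
       runs-perform refl)

    Halts : List Bool → Set
    Halts w = ∃[ t ] t ≤ Time.totalTime size n ×
      TuringMachine._⇓[_]_ machine (TuringMachine.initial machine (encodeGraph (n , G))) t w

    input-written : at [] (replicate n 𝟙 ++ bit false ∷ inputRows G (allFin n)) ≡
                    write (encodeGraph (n , G))
    input-written = trans (cong (at []) (sym encoded)) (written (encodeGraph (n , G)))
      where
      written : ∀ w → at [] (map bit w) ≡ write w
      written []      = refl
      written (b ∷ w) = refl

    reduction-halts : Halts (encodeFormula formula)
    reduction-halts = subst Halts (read-output (encodeFormula formula))
      (runs-halts {w = encodeGraph (n , G)}
        {I ∷ move right (formulaTape formula) ∷ others}
        (subst (λ t → Runs reduction (Time.totalTime size n) (t ∷ Vec.replicate 5 blankTape)
                        (I ∷ move right (formulaTape formula) ∷ others))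
          input-written (proj₂ (proj₂ runs-reduction))))
      where
      I = proj₁ runs-reduction
      others = proj₁ (proj₂ runs-reduction)

  formula-polytime : ∀ {𝓕} → PolyTime (FreeColouring 𝓕) 2-SAT λ (n , G) → Reduce.formula K G
  -- The time is below a power of 2 + n, and 2 + n is at most twice the input length, which exceeds
  -- n because of the unary prefix. The factor 2 becomes the coefficient `2 ^ degree`.
  formula-polytime {𝓕} = machine , 2 ^ degree , degree , λ (n , G) →
    let t , t≤ , halts = reduction-halts G in
    t , ℕ.≤-trans t≤ (ℕ.≤-trans (polynomial n) (ℕ.≤-trans (ℕ.^-monoˡ-≤ degree (2+n≤ n G))
      (ℕ.≤-trans (ℕ.≤-reflexive (*-^ 2 (length (encodeGraph (n , G))) degree)) (ℕ.m≤m+n _ _)))) , halts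
    where
    degree = proj₁ (poly-total size)
    polynomial = proj₂ (poly-total size)

    2+n≤ : ∀ n (G : Graph n) → 2 + n ≤ 2 * length (encodeGraph (n , G))
    2+n≤ n G = ℕ.≤-trans (ℕ.+-monoʳ-≤ 2 (ℕ.m≤m+n n n))
      (ℕ.≤-trans (ℕ.≤-reflexive (double n)) (ℕ.*-monoʳ-≤ 2 1+n≤))
      where
      double : ∀ n → 2 + (n + n) ≡ 2 * suc n
      double n = cong suc (trans (sym (ℕ.+-suc n n)) (cong (λ k → n + suc k) (sym (ℕ.+-identityʳ n))))

      1+n≤ : suc n ≤ length (encodeGraph (n , G))
      1+n≤ = ℕ.≤-trans (ℕ.≤-reflexive (sym (trans (length-++ (replicate n true))
               (trans (cong (_+ 1) (length-replicate n)) (ℕ.+-comm n 1)))))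
             (ℕ.≤-trans (ℕ.m≤m+n _ _) (ℕ.≤-reflexive (sym (length-++ (unary n)))))

-- Four pairs of colours times three pairs of slots. A bound common to all patterns gives every
-- visit the same time.
constraints-bounded : ∀ g → length (constraints g) ≤ 12
constraints-bounded g =
  over-bools (λ x → concatMap (exclusions g x) bools) λ x → over-bools (exclusions g x) (three x)
  where
  over-bools : ∀ {A : Set} (f : Bool → List A) {k} → (∀ b → length (f b) ≤ k) →
               length (concatMap f bools) ≤ k + (k + 0)
  over-bools f f≤ = ℕ.≤-trans
    (ℕ.≤-reflexive (trans (length-++ (f true)) (cong (length (f true) +_) (length-++ (f false)))))
    (ℕ.+-mono-≤ (f≤ true) (ℕ.+-monoˡ-≤ 0 (f≤ false)))

  single : ∀ b (c : LocalClause) → length (singleton-if b c) ≤ 1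
  single true  c = ℕ.≤-refl
  single false c = z≤n

  three : ∀ x y → length (exclusions g x y) ≤ 3
  three x y = ℕ.≤-trans
    (ℕ.≤-reflexive (trans (length-++ (singleton-if p _))
      (cong (length (singleton-if p _) +_) (length-++ (singleton-if q _)))))
    (ℕ.+-mono-≤ (single p _) (ℕ.+-mono-≤ (single q _) (single (g true x y ∧ g false x y) _)))
    where
    p = g x y true ∧ g x y false
    q = g x true y ∧ g x false y

lemma36 : (𝓕 : List (ColouredGraph 3)) →
    TrianglesOf 𝓕 Are []
    ⊎ All (_∈≅ 𝓕) triangles
    ⊎ TrianglesOf 𝓕 Are (rK₃ ∷ rrbK₃ ∷ [])
    ⊎ TrianglesOf 𝓕 Are (bK₃ ∷ rbbK₃ ∷ []) →
    FreeColouring 𝓕 ≤ₚ 2-SAT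
lemma36 𝓕 cases =
  (λ (n , G) → Reduce.formula (clauses 𝓕) G) ,
  formula-polytime (clauses 𝓕) (λ a b c → constraints-bounded (forbidden 𝓕 a b c)) {𝓕} ,
  λ (n , G) → mk⇔ (λ (c , free) → free⇒satisfiable 𝓕 G c free) (satisfiable⇒free 𝓕 G (stable cases))
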